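{- Let $\Delta\ge 41$ be an integer and $k=\lceil 27\Delta\ln\Delta\rceil$. If $G$ is a graph with maximum degree $\Delta$ and $Y$ is an independent set of vertices in $G$, then the set $E_G(Y,V(G)\setminus Y)$ of edges with one end in $Y$ and the other in $V(G)\setminus Y$ can be partitioned into $k$ $G$-good sets.
   Context: All graphs are finite and simple; $\ln$ is the natural logarithm. A set $F$ of edges of $G$ is \emph{$G$-good} if no two distinct edges $e,f\in F$ satisfy either (i) $e$ and $f$ share no vertex and some edge of $G$ joins an endpoint of $e$ to an endpoint of $f$, or (ii) $e$ and $f$ lie in a common triangle of $G$. (A partition into $k$ sets may have some empty parts.) -}

module Defs where

open import Algebra.Properties.Group using () renaming (⁻¹-involutive to group-⁻¹-involutive)
open import Data.Fin.Base as Fin using (Fin)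
open import Data.Fin.Subset using (Subset; _∈_; _∉_)
open import Data.Integer.Base as ℤ using (ℤ; +_; +[1+_])
import Data.Integer.Properties as ℤ
open import Data.List.Base using (length; map; filter; allFin)
open import Data.List.Extrema.Nat using (max)
open import Data.Nat.Base as ℕ using (ℕ; zero; suc; NonZero)
import Data.Nat.Properties as ℕ
open import Data.Product.Base using (∃-syntax; ∃₂; _×_; _,_)
open import Data.Rational.Base using (ℚ; mkℚ; 0ℚ; 1ℚ; _/_; _+_; _*_; _-_; -_; ∣_∣; _≤_; _<_; *≤*; toℚᵘ; Positive; NonNegative; positive)
import Data.Rational.Properties as ℚ
open import Data.Rational.Unnormalised.Base as ℚᵘ using (mkℚᵘ; *≡*)
import Data.Rational.Unnormalised.Properties as ℚᵘ
open import Data.Sum.Base using (_⊎_; inj₁; inj₂)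
open import Level using (0ℓ)
open import Relation.Binary.Core using (Rel)
open import Relation.Binary.Definitions using (Symmetric; Irreflexive; Decidable)
open import Relation.Binary.PropositionalEquality using (_≡_; _≢_; refl; sym; trans; cong; cong₂; subst; subst₂)
open import Relation.Nullary using (¬_)
open import Relation.Unary using (Pred; _≐_; _⊥_; ⋃)

record ℝ : Set where
  field
    seq    : ℕ → ℚ
    cauchy : ∀ ε → 0ℚ < ε →
             ∃[ N ] ∀ m n → N ℕ.≤ m → N ℕ.≤ n → ∣ seq m - seq n ∣ ≤ ε

open ℝ public

infix 4 _≤ᴿ_

_≤ᴿ_ : Rel ℝ 0ℓ
x ≤ᴿ y = ∀ ε → 0ℚ < ε → ∃[ N ] ∀ n → N ℕ.≤ n → seq x n ≤ seq y n + ε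

fromℤ : ℤ → ℝ
fromℤ z = record
  { seq    = λ _ → z / 1
  ; cauchy = λ ε 0<ε → 0 , λ _ _ _ _ →
      subst (λ p → ∣ p ∣ ≤ ε) (sym (ℚ.+-inverseʳ (z / 1))) (ℚ.<⇒≤ 0<ε)
  }

module RationalLemmas where

  unit-nonNeg : ∀ m d .{{_ : NonZero d}} → NonNegative (+ m / d)
  unit-nonNeg m d = ℚ.normalize-nonNeg m d

  p≤p+unit : ∀ p d → p ≤ p + + 1 / suc d
  p≤p+unit p d = ℚ.≤-trans (ℚ.≤-reflexive (sym (ℚ.+-identityʳ p)))
    (ℚ.+-monoʳ-≤ p (ℚ.nonNegative⁻¹ (+ 1 / suc d) {{unit-nonNeg 1 (suc d)}}))

  toℚᵘ-/ : ∀ z d → toℚᵘ (z / suc d) ℚᵘ.≃ mkℚᵘ z d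
  toℚᵘ-/ z d = ℚ.toℚᵘ-fromℚᵘ (mkℚᵘ z d)

  /-mono : ∀ a b c d → a ℕ.* suc d ℕ.≤ c ℕ.* suc b → + a / suc b ≤ + c / suc d
  /-mono a b c d h = ℚ.toℚᵘ-cancel-≤
    (ℚᵘ.≤-respˡ-≃ (ℚᵘ.≃-sym (toℚᵘ-/ (+ a) b))
      (ℚᵘ.≤-respʳ-≃ (ℚᵘ.≃-sym (toℚᵘ-/ (+ c) d))
        (ℚᵘ.*≤* (subst₂ ℤ._≤_ (ℤ.pos-* a (suc d)) (ℤ.pos-* c (suc b)) (ℤ.+≤+ h)))))

  /-suc : ∀ m d → + m / suc d + + 1 / suc d ≡ + suc m / suc d
  /-suc m d = ℚ.toℚᵘ-injective
    (ℚᵘ.≃-trans (ℚ.toℚᵘ-homo-+ (+ m / suc d) (+ 1 / suc d))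
    (ℚᵘ.≃-trans (ℚᵘ.+-cong (toℚᵘ-/ (+ m) d) (toℚᵘ-/ (+ 1) d))
    (ℚᵘ.≃-trans (*≡* eq) (ℚᵘ.≃-sym (toℚᵘ-/ (+ suc m) d)))))
    where
    D = + suc d
    eq : ((+ m) ℤ.* D ℤ.+ (+ 1) ℤ.* D) ℤ.* D ≡ (+ suc m) ℤ.* (+ (suc d ℕ.* suc d))
    eq = trans (cong (ℤ._* D) (trans (sym (ℤ.*-distribʳ-+ D (+ m) (+ 1)))
                                     (cong (λ k → + k ℤ.* D) (ℕ.+-comm m 1))))
               (trans (ℤ.*-assoc (+ suc m) D D)
                      (cong ((+ suc m) ℤ.*_) (sym (ℤ.pos-* (suc d) (suc d)))))

  /1*unit≤1 : ∀ c → (+ c / 1) * (+ 1 / suc c) ≤ 1ℚ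
  /1*unit≤1 c = ℚ.toℚᵘ-cancel-≤
    (ℚᵘ.≤-respˡ-≃
      (ℚᵘ.≃-sym (ℚᵘ.≃-trans (ℚ.toℚᵘ-homo-* (+ c / 1) (+ 1 / suc c))
                             (ℚᵘ.*-cong (toℚᵘ-/ (+ c) 0) (toℚᵘ-/ (+ 1) c))))
      (ℚᵘ.*≤* (subst₂ ℤ._≤_
        (sym (trans (ℤ.*-identityʳ _) (ℤ.*-identityʳ (+ c))))
        (trans (cong +_ (sym (ℕ.+-identityʳ (suc c)))) (sym (ℤ.*-identityˡ (+ (1 ℕ.* suc c)))))
        (ℤ.+≤+ (ℕ.n≤1+n c)))))

open RationalLemmas

infixr 7 _·_

_·_ : ℕ → ℝ → ℝ
c · x = record { seq = λ n → c′ * seq x n ; cauchy = λ ε 0<ε → bound ε (positive 0<ε) }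
  where
  c′ u : ℚ
  c′ = + c / 1
  u = + 1 / suc c
  instance
    c′≥0 : NonNegative c′
    c′≥0 = unit-nonNeg c 1
    u>0 : Positive u
    u>0 = ℚ.normalize-pos 1 (suc c)
  bound : ∀ ε → Positive ε →
          ∃[ N ] ∀ m n → N ℕ.≤ m → N ℕ.≤ n → ∣ c′ * seq x m - c′ * seq x n ∣ ≤ ε
  bound ε pε with cauchy x (u * ε) (ℚ.positive⁻¹ (u * ε) {{ℚ.pos*pos⇒pos u ε {{pε}}}})
  ... | N , h = N , λ m n N≤m N≤n → begin
    ∣ c′ * seq x m - c′ * seq x n ∣      ≡⟨ cong (λ p → ∣ c′ * seq x m + p ∣) (ℚ.neg-distribʳ-* c′ (seq x n)) ⟩
    ∣ c′ * seq x m + c′ * - seq x n ∣    ≡⟨ cong ∣_∣ (sym (ℚ.*-distribˡ-+ c′ (seq x m) (- seq x n))) ⟩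
    ∣ c′ * (seq x m - seq x n) ∣         ≡⟨ ℚ.∣p*q∣≡∣p∣*∣q∣ c′ (seq x m - seq x n) ⟩
    ∣ c′ ∣ * ∣ seq x m - seq x n ∣       ≡⟨ cong (_* ∣ seq x m - seq x n ∣) (ℚ.0≤p⇒∣p∣≡p (ℚ.nonNegative⁻¹ c′)) ⟩
    c′ * ∣ seq x m - seq x n ∣           ≤⟨ ℚ.*-monoˡ-≤-nonNeg c′ (h m n N≤m N≤n) ⟩
    c′ * (u * ε)                         ≡⟨ sym (ℚ.*-assoc c′ u ε) ⟩
    c′ * u * ε                           ≤⟨ ℚ.*-monoʳ-≤-nonNeg ε {{ℚ.pos⇒nonNeg ε {{pε}}}} (/1*unit≤1 c) ⟩
    1ℚ * ε                               ≡⟨ ℚ.*-identityˡ ε ⟩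
    ε ∎
    where open ℚ.≤-Reasoning

-- A relation, since the ceiling of a Cauchy real is not computable.
IsCeiling : ℝ → ℤ → Set
IsCeiling x k = x ≤ᴿ fromℤ k × (∀ m → x ≤ᴿ fromℤ m → k ℤ.≤ m)

∑< : ℕ → (ℕ → ℚ) → ℚ
∑< zero    f = 0ℚ
∑< (suc n) f = ∑< n f + f n

-- The right-endpoint Riemann sum of ∫₁ⁿ dt/t with mesh 1/N, where N = k + 1:
-- there are (n - 1)N intervals, and the one ending at 1 + (i + 1)/N
-- contributes (1/N) · 1/(1 + (i + 1)/N) = 1/(N + i + 1).
lnSum : ℕ → ℕ → ℚ
lnSum n k = ∑< ((n ℕ.∸ 1) ℕ.* suc k) (λ i → + 1 / suc (suc k ℕ.+ i))

module LnLemmas where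

  -- 1/(a + 1) + ⋯ + 1/(a + m)
  H : ℕ → ℕ → ℚ
  H a m = ∑< m (λ i → + 1 / suc (a ℕ.+ i))

  H-split : ∀ a m l → H a (m ℕ.+ l) ≡ H a m + H (a ℕ.+ m) l
  H-split a m zero rewrite ℕ.+-identityʳ m = sym (ℚ.+-identityʳ (H a m))
  H-split a m (suc l) rewrite ℕ.+-suc m l =
    trans (cong₂ _+_ (H-split a m l) (cong (λ j → + 1 / suc j) (sym (ℕ.+-assoc a m l))))
          (ℚ.+-assoc (H a m) (H (a ℕ.+ m) l) _)

  H-upper : ∀ a m d → d ℕ.≤ a → H a m ≤ + m / suc d
  H-upper a zero    d d≤a = /-mono 0 0 0 d ℕ.z≤n
  H-upper a (suc m) d d≤a = ℚ.≤-trans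
    (ℚ.+-mono-≤ (H-upper a m d d≤a)
      (/-mono 1 (a ℕ.+ m) 1 d
        (ℕ.+-monoˡ-≤ 0 (ℕ.s≤s (ℕ.≤-trans d≤a (ℕ.m≤m+n a m))))))
    (ℚ.≤-reflexive (/-suc m d))

  H-lower : ∀ a m d → a ℕ.+ m ℕ.≤ suc d → + m / suc d ≤ H a m
  H-lower a zero    d h = /-mono 0 d 0 0 ℕ.z≤n
  H-lower a (suc m) d h = ℚ.≤-trans (ℚ.≤-reflexive (sym (/-suc m d)))
    (ℚ.+-mono-≤ (H-lower a m d (ℕ.≤-trans (ℕ.n≤1+n _) h′))
      (/-mono 1 d 1 (a ℕ.+ m) (ℕ.+-monoˡ-≤ 0 h′)))
    where
    h′ : suc (a ℕ.+ m) ℕ.≤ suc d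
    h′ = subst (ℕ._≤ suc d) (ℕ.+-suc a m) h

  module _ (p : ℕ) where

    A : ℕ → ℚ
    A = lnSum (suc p)

    block : ℕ → ℚ
    block k = H (suc k ℕ.+ p ℕ.* suc k) (suc p)

    -- both sides are 1/(N + 1) + ⋯ + 1/((p + 1)(N + 1)), with N = k + 1
    step : ∀ k → + 1 / suc (suc k) + A (suc k) ≡ A k + block k
    step k = trans (cong₂ _+_ head tail) (trans (sym (H-split (suc k) 1 (p ℕ.* suc (suc k))))
             (trans (cong (H (suc k)) len) (H-split (suc k) (p ℕ.* suc k) (suc p))))
      where
      head : + 1 / suc (suc k) ≡ H (suc k) 1
      head = trans (cong (λ j → + 1 / suc j) (sym (ℕ.+-identityʳ (suc k)))) (sym (ℚ.+-identityˡ _))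
      tail : A (suc k) ≡ H (suc k ℕ.+ 1) (p ℕ.* suc (suc k))
      tail = cong (λ a → H a (p ℕ.* suc (suc k))) (ℕ.+-comm 1 (suc k))
      len : 1 ℕ.+ p ℕ.* suc (suc k) ≡ p ℕ.* suc k ℕ.+ suc p
      len = trans (cong suc (trans (ℕ.*-suc p (suc k)) (ℕ.+-comm p _))) (sym (ℕ.+-suc _ p))

    block-lower : ∀ k → + 1 / suc (suc k) ≤ block k
    block-lower k = ℚ.≤-trans
      (/-mono 1 (suc k) (suc p) d (ℕ.≤-reflexive (ℕ.+-identityʳ _)))
      (H-lower (suc k ℕ.+ p ℕ.* suc k) (suc p) d (ℕ.≤-reflexive eq))
      where
      d = suc k ℕ.+ p ℕ.* suc (suc k)
      eq : suc p ℕ.* suc k ℕ.+ suc p ≡ suc p ℕ.* suc (suc k)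
      eq = trans (ℕ.+-comm _ (suc p)) (sym (ℕ.*-suc (suc p) (suc k)))

    block-upper : ∀ k → block k ≤ + 1 / suc k
    block-upper k = ℚ.≤-trans
      (H-upper (suc k ℕ.+ p ℕ.* suc k) (suc p) (k ℕ.+ p ℕ.* suc k) (ℕ.n≤1+n _))
      (/-mono (suc p) (k ℕ.+ p ℕ.* suc k) 1 k (ℕ.≤-reflexive (sym (ℕ.+-identityʳ _))))

    A-mono₁ : ∀ k → A k ≤ A (suc k)
    A-mono₁ k = ℚ.≤-trans (ℚ.≤-reflexive (sym (cancel (A k) u))) (ℚ.≤-trans
      (ℚ.+-monoˡ-≤ (- u) (ℚ.≤-trans (ℚ.+-monoʳ-≤ (A k) (block-lower k))
        (ℚ.≤-reflexive (trans (sym (step k)) (ℚ.+-comm u (A (suc k)))))))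
      (ℚ.≤-reflexive (cancel (A (suc k)) u)))
      where
      u = + 1 / suc (suc k)
      cancel : ∀ q r → (q + r) + - r ≡ q
      cancel q r = trans (ℚ.+-assoc q r (- r))
                   (trans (cong (λ s → q + s) (ℚ.+-inverseʳ r)) (ℚ.+-identityʳ q))

    B-anti₁ : ∀ k → A (suc k) + + 1 / suc (suc k) ≤ A k + + 1 / suc k
    B-anti₁ k = ℚ.≤-trans (ℚ.≤-reflexive (trans (ℚ.+-comm (A (suc k)) _) (step k)))
                          (ℚ.+-monoʳ-≤ (A k) (block-upper k))

    A-mono : ∀ k l → A k ≤ A (l ℕ.+ k)
    A-mono k zero    = ℚ.≤-refl
    A-mono k (suc l) = ℚ.≤-trans (A-mono k l) (A-mono₁ (l ℕ.+ k))

    B-anti : ∀ k l → A (l ℕ.+ k) + + 1 / suc (l ℕ.+ k) ≤ A k + + 1 / suc k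
    B-anti k zero    = ℚ.≤-refl
    B-anti k (suc l) = ℚ.≤-trans (B-anti₁ (l ℕ.+ k)) (B-anti k l)

    A-close : ∀ k l → A (l ℕ.+ k) - A k ≤ + 1 / suc k
    A-close k l = begin
      A (l ℕ.+ k) - A k            ≤⟨ ℚ.+-monoˡ-≤ (- A k) (ℚ.≤-trans
                                        (p≤p+unit (A (l ℕ.+ k)) (l ℕ.+ k))
                                        (B-anti k l)) ⟩
      (A k + v) - A k              ≡⟨ cong (_- A k) (ℚ.+-comm (A k) v) ⟩
      (v + A k) - A k              ≡⟨ ℚ.+-assoc v (A k) (- A k) ⟩
      v + (A k - A k)              ≡⟨ cong (λ q → v + q) (ℚ.+-inverseʳ (A k)) ⟩
      v + 0ℚ                       ≡⟨ ℚ.+-identityʳ v ⟩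
      v ∎
      where
      open ℚ.≤-Reasoning
      v = + 1 / suc k

    A-dist : ∀ {k m} → k ℕ.≤ m → ∣ A m - A k ∣ ≤ + 1 / suc k
    A-dist {k} {m} k≤m = subst (λ j → ∣ A j - A k ∣ ≤ + 1 / suc k) (ℕ.m∸n+n≡m k≤m)
      (ℚ.≤-trans (ℚ.≤-reflexive (ℚ.0≤p⇒∣p∣≡p
          (ℚ.≤-trans (ℚ.≤-reflexive (sym (ℚ.+-inverseʳ (A k))))
                     (ℚ.+-monoˡ-≤ (- A k) (A-mono k (m ℕ.∸ k))))))
        (A-close k (m ℕ.∸ k)))

    ∣-∣-swap : ∀ q r → ∣ q - r ∣ ≡ ∣ r - q ∣
    ∣-∣-swap q r = trans (sym (ℚ.∣-p∣≡∣p∣ (q - r)))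
      (cong ∣_∣ (trans (ℚ.neg-distrib-+ q (- r))
        (trans (cong (λ s → - q + s) (group-⁻¹-involutive ℚ.+-0-group r)) (ℚ.+-comm (- q) r))))

    A-cauchy : ∀ N m n → N ℕ.≤ m → N ℕ.≤ n → ∣ A m - A n ∣ ≤ + 1 / suc N
    A-cauchy N m n N≤m N≤n with ℕ.≤-total n m
    ... | inj₁ n≤m = ℚ.≤-trans (A-dist n≤m) (/-mono 1 n 1 N (ℕ.+-monoˡ-≤ 0 (ℕ.s≤s N≤n)))
    ... | inj₂ m≤n = ℚ.≤-trans (ℚ.≤-reflexive (∣-∣-swap (A m) (A n)))
                       (ℚ.≤-trans (A-dist m≤n) (/-mono 1 m 1 N (ℕ.+-monoˡ-≤ 0 (ℕ.s≤s N≤m))))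

  archimedean : ∀ ε → Positive ε → ∃[ N ] + 1 / suc N ≤ ε
  archimedean ε@(mkℚ +[1+ n ] d _) _ = d ,
    ℚ.≤-trans (/-mono 1 d (suc n) d (ℕ.*-monoˡ-≤ (suc d) {1} {suc n} (ℕ.s≤s ℕ.z≤n)))
              (ℚ.≤-reflexive (ℚ.↥p/↧p≡p ε))

  lnSum-cauchy : ∀ n ε → 0ℚ < ε →
                 ∃[ N ] ∀ m l → N ℕ.≤ m → N ℕ.≤ l → ∣ lnSum n m - lnSum n l ∣ ≤ ε
  lnSum-cauchy zero    ε 0<ε = 0 , λ _ _ _ _ → ℚ.<⇒≤ 0<ε
  lnSum-cauchy (suc p) ε 0<ε with archimedean ε (positive 0<ε)
  ... | N , h = N , λ m l N≤m N≤l → ℚ.≤-trans (A-cauchy p N m l N≤m N≤l) h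

-- ln n = ∫₁ⁿ dt/t for n ≥ 1; ln 0 is a junk value (0).
ln : ℕ → ℝ
ln n = record { seq = lnSum n ; cauchy = LnLemmas.lnSum-cauchy n }

record Graph : Set₁ where
  infix 4 _~_ _~?_
  field
    order  : ℕ
    _~_    : Rel (Fin order) 0ℓ
    _~?_   : Decidable _~_
    ~-sym  : Symmetric _~_
    ~-irr  : Irreflexive _≡_ _~_

  Vertex : Set
  Vertex = Fin order

  degree : Vertex → ℕ
  degree v = length (filter (v ~?_) (allFin order))

  maxDegree : ℕ
  maxDegree = max 0 (map degree (allFin order))

  -- An unordered pair of adjacent vertices, listed in increasing order. The
  -- proof fields are irrelevant, so edges with the same ends are equal.
  record Edge : Set where
    field
      end₁ end₂  : Vertex
      .ordered   : end₁ Fin.< end₂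
      .adjacent  : end₁ ~ end₂

  EdgeSet : Set₁
  EdgeSet = Pred Edge 0ℓ

  infix 4 _∈ₑ_
  _∈ₑ_ : Vertex → Edge → Set
  v ∈ₑ e = v ≡ Edge.end₁ e ⊎ v ≡ Edge.end₂ e

  ShareVertex : Rel Edge 0ℓ
  ShareVertex e f = ∃[ v ] (v ∈ₑ e × v ∈ₑ f)

  Joined : Rel Edge 0ℓ
  Joined e f = ∃₂ λ u v → u ∈ₑ e × v ∈ₑ f × u ~ v

  InTriangle : Vertex → Vertex → Vertex → Edge → Set
  InTriangle a b c e = ∀ v → v ∈ₑ e → v ≡ a ⊎ v ≡ b ⊎ v ≡ c

  InCommonTriangle : Rel Edge 0ℓ
  InCommonTriangle e f =
    ∃[ a ] ∃[ b ] ∃[ c ] (a ~ b × b ~ c × a ~ c × InTriangle a b c e × InTriangle a b c f)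

  Good : EdgeSet → Set
  Good F = ∀ e f → F e → F f → e ≢ f →
           ¬ ((¬ ShareVertex e f × Joined e f) ⊎ InCommonTriangle e f)

  Independent : Subset order → Set
  Independent Y = ∀ u v → u ∈ Y → v ∈ Y → ¬ (u ~ v)

  -- E_G(Y, V(G) ∖ Y)
  EdgeBoundary : Subset order → EdgeSet
  EdgeBoundary Y e = ∃₂ λ u v → u ∈ₑ e × v ∈ₑ e × u ∈ Y × v ∉ Y

-- Parts may be empty.
IsPartition : ∀ {A : Set} {k} → Pred A 0ℓ → (Fin k → Pred A 0ℓ) → Set
IsPartition {k = k} S P = S ≐ ⋃ (Fin k) P × (∀ i j → i ≢ j → P i ⊥ P j)

{-# OPTIONS --safe #-}

-- Write b = 4Δ and choose l with 2^l ≤ Δ < 2^(l+1) and t = 3l + 7. In each of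
-- t independent rounds every vertex draws a uniform label from b labels. For an
-- edge yx, a round is a failure if some z ≠ x in N(y) ∪ N(x) has the label of x;
-- by the union bound this has probability at most 2Δ/b = 1/2, so all t rounds
-- fail with probability at most 2^-t. That event depends only on the labels in
-- N(y) ∪ N(x), hence is independent of all but 4Δ³ of the others, and
-- 4 · 4Δ³ ≤ 2^t, so by the local lemma some labelling has a successful round for
-- every edge. Colour yx (with y ∈ Y) by a successful round together with the
-- label of x in that round. If yx and y′x′ have the same colour and x ≠ x′, then
-- x′ is adjacent neither to y nor to x, and x is not adjacent to y′; this
-- excludes both kinds of conflict, as Y is independent. The number of colours
-- is tb = Δ(12l + 28), and ln Δ ≥ 1/2 + ⋯ + 1/Δ ≥ (12l + 28)/27 for Δ ≥ 41.

module Submission where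

open import Algebra.Properties.CommutativeSemigroup using (interchange; x∙yz≈y∙xz)
open import Data.Bool.Base using (Bool; true; false; not; _∧_; _∨_)
open import Data.Bool.ListAction using (any)
open import Data.Bool.Properties using (T?; ∧-identityʳ; ∨-zeroʳ; ∨-conicalˡ; ∨-conicalʳ; not-injective)
open import Data.Empty using (⊥)
open import Data.Fin.Base as Fin using (Fin; zero; suc; combine; inject≤)
import Data.Fin.Properties as Fin
open import Data.Fin.Subset using (Subset) renaming (_∈_ to _∈ˢ_)
open import Data.Fin.Subset.Properties using (_∈?_)
open import Data.Integer.Base as ℤ using (+_)
import Data.Integer.Properties as ℤ
open import Data.List.Base using (List; []; _∷_; _++_; map; length; concatMap; allFin; filter; filterᵇ; cartesianProduct)
open import Data.List.Extrema.Nat using (xs≤max)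
open import Data.List.Membership.Propositional using (_∈_)
open import Data.List.Membership.Propositional.Properties using (∈-allFin; ∈-map⁺; ∈-cartesianProduct⁺)
open import Data.List.Properties using (map-++; map-∘; map-tabulate; length-tabulate)
open import Data.List.Relation.Unary.All as All using (All; []; _∷_)
open import Data.List.Relation.Unary.Any using (here; there)
open import Data.Nat.Base hiding (_/_)
open import Data.Nat.ListAction using (sum)
open import Data.Nat.ListAction.Properties using (sum-++)
open import Data.Nat.Properties
open import Data.Nat.Tactic.RingSolver using (solve-∀)
open import Data.Product.Base using (Σ-syntax; ∃-syntax; _×_; _,_; proj₁; proj₂)
open import Data.Rational.Base as ℚ using (_/_)
import Data.Rational.Properties as ℚ
open import Data.Rational.Unnormalised.Base using (*≡*)
import Data.Rational.Unnormalised.Properties as ℚᵘ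
open import Data.Sum.Base using (_⊎_; inj₁; inj₂)
open import Data.Unit.Base using (tt)
open import Data.Vec.Base using (Vec; []; _∷_; lookup)
open import Function.Base using (_∘_; flip)
open import Relation.Binary.PropositionalEquality using (_≡_; _≢_; refl; sym; trans; cong; cong₂; subst; subst₂; module ≡-Reasoning)
open import Relation.Nullary.Decidable using (Dec; does; yes; no; dec-true; dec-false; recompute; toWitness)
open import Relation.Nullary.Negation using (¬_; contradiction)
open import Defs
open RationalLemmas using (/-mono; /-suc; toℚᵘ-/; unit-nonNeg)
open LnLemmas using (H; H-split; H-lower; A-mono)

private variable
  A B : Set

-- Indicators and finite sums

𝟙 : Bool → ℕ
𝟙 true  = 1
𝟙 false = 0

∑ : List A → (A → ℕ) → ℕ
∑ xs f = sum (map f xs)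

𝟙≤1 : ∀ p → 𝟙 p ≤ 1
𝟙≤1 true  = ≤-refl
𝟙≤1 false = z≤n

𝟙-∧ : ∀ p q → 𝟙 (p ∧ q) ≡ 𝟙 p * 𝟙 q
𝟙-∧ true  q = sym (+-identityʳ (𝟙 q))
𝟙-∧ false q = refl

𝟙-∧-≤ʳ : ∀ p q → 𝟙 (p ∧ q) ≤ 𝟙 q
𝟙-∧-≤ʳ true  q = ≤-refl
𝟙-∧-≤ʳ false q = z≤n

∧-congʳ-if : ∀ p {q r} → (p ≡ true → q ≡ r) → p ∧ q ≡ p ∧ r
∧-congʳ-if true  eq = eq refl
∧-congʳ-if false eq = refl

^-distribʳ-* : ∀ m n o → (m * n) ^ o ≡ m ^ o * n ^ o
^-distribʳ-* m n zero    = refl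
^-distribʳ-* m n (suc o) = trans (cong (m * n *_) (^-distribʳ-* m n o))
  (interchange *-commutativeSemigroup m n (m ^ o) (n ^ o))

𝟙-∨ : ∀ p q → 𝟙 (p ∨ q) ≤ 𝟙 p + 𝟙 q
𝟙-∨ true  q = m≤m+n 1 (𝟙 q)
𝟙-∨ false q = ≤-refl

𝟙-not : ∀ p → 𝟙 (not p) + 𝟙 p ≡ 1
𝟙-not true  = refl
𝟙-not false = refl

∑-cong : ∀ (xs : List A) {f g} → (∀ x → f x ≡ g x) → ∑ xs f ≡ ∑ xs g
∑-cong []       h = refl
∑-cong (x ∷ xs) h = cong₂ _+_ (h x) (∑-cong xs h)

∑-mono : ∀ (xs : List A) {f g} → (∀ x → f x ≤ g x) → ∑ xs f ≤ ∑ xs g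
∑-mono []       h = z≤n
∑-mono (x ∷ xs) h = +-mono-≤ (h x) (∑-mono xs h)

∑-+ : ∀ (xs : List A) f g → ∑ xs (λ x → f x + g x) ≡ ∑ xs f + ∑ xs g
∑-+ []       f g = refl
∑-+ (x ∷ xs) f g = trans (cong (λ s → f x + g x + s) (∑-+ xs f g))
  (interchange +-commutativeSemigroup (f x) (g x) (∑ xs f) (∑ xs g))

∑-*ˡ : ∀ (xs : List A) c f → ∑ xs (λ x → c * f x) ≡ c * ∑ xs f
∑-*ˡ []       c f = sym (*-zeroʳ c)
∑-*ˡ (x ∷ xs) c f = trans (cong (λ s → c * f x + s) (∑-*ˡ xs c f)) (sym (*-distribˡ-+ c (f x) (∑ xs f)))

∑-*ʳ : ∀ (xs : List A) c f → ∑ xs (λ x → f x * c) ≡ ∑ xs f * c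
∑-*ʳ xs c f = trans (∑-cong xs (λ x → *-comm (f x) c)) (trans (∑-*ˡ xs c f) (*-comm c (∑ xs f)))

∑-const : ∀ (xs : List A) c → ∑ xs (λ _ → c) ≡ length xs * c
∑-const []       c = refl
∑-const (x ∷ xs) c = cong (λ s → c + s) (∑-const xs c)

∑-swap : ∀ (xs : List A) (ys : List B) f →
         ∑ xs (λ x → ∑ ys (f x)) ≡ ∑ ys (λ y → ∑ xs (flip f y))
∑-swap []       ys f = sym (trans (∑-const ys 0) (*-zeroʳ (length ys)))
∑-swap (x ∷ xs) ys f = trans (cong (λ s → ∑ ys (f x) + s) (∑-swap xs ys f))
  (sym (∑-+ ys (f x) (λ y → ∑ xs (flip f y))))

∑-++ : ∀ (xs ys : List A) f → ∑ (xs ++ ys) f ≡ ∑ xs f + ∑ ys f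
∑-++ xs ys f = trans (cong sum (map-++ f xs ys)) (sum-++ (map f xs) (map f ys))

∑-concatMap : ∀ (h : A → List B) xs f → ∑ (concatMap h xs) f ≡ ∑ xs (λ x → ∑ (h x) f)
∑-concatMap h []       f = refl
∑-concatMap h (x ∷ xs) f =
  trans (∑-++ (h x) (concatMap h xs) f) (cong (λ s → ∑ (h x) f + s) (∑-concatMap h xs f))

∑-map : ∀ (h : A → B) xs f → ∑ (map h xs) f ≡ ∑ xs (f ∘ h)
∑-map h xs f = cong sum (sym (map-∘ xs))

∑-cartesianProduct : ∀ (xs : List A) (ys : List B) f →
                     ∑ (cartesianProduct xs ys) f ≡ ∑ xs (λ x → ∑ ys (λ y → f (x , y)))
∑-cartesianProduct []       ys f = refl
∑-cartesianProduct (x ∷ xs) ys f = trans (∑-++ (map (x ,_) ys) (cartesianProduct xs ys) f)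
  (cong₂ _+_ (∑-map (x ,_) ys f) (∑-cartesianProduct xs ys f))

∑-positive : ∀ (xs : List A) f → 0 < ∑ xs f → ∃[ x ] 0 < f x
∑-positive (x ∷ xs) f 0<∑ with f x in eq
... | suc _ = x , subst (0 <_) (sym eq) z<s
... | zero  = ∑-positive xs f 0<∑

length-∑ : ∀ (xs : List A) → length xs ≡ ∑ xs (λ _ → 1)
length-∑ xs = sym (trans (∑-const xs 1) (*-identityʳ (length xs)))

length-filter : ∀ {P : A → Set} (P? : ∀ x → Dec (P x)) xs →
                length (filter P? xs) ≡ ∑ xs (𝟙 ∘ does ∘ P?)
length-filter P? []       = refl
length-filter P? (x ∷ xs) with does (P? x)
... | true  = cong suc (length-filter P? xs)
... | false = length-filter P? xs

∑-any : ∀ (p : A → Bool) xs → 𝟙 (any p xs) ≤ ∑ xs (𝟙 ∘ p)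
∑-any p []       = z≤n
∑-any p (x ∷ xs) = ≤-trans (𝟙-∨ (p x) (any p xs)) (+-monoʳ-≤ (𝟙 (p x)) (∑-any p xs))

any-cong : ∀ {p q : A → Bool} xs → (∀ x → p x ≡ q x) → any p xs ≡ any q xs
any-cong []       p≡q = refl
any-cong (x ∷ xs) p≡q = cong₂ _∨_ (p≡q x) (any-cong xs p≡q)

any-false : ∀ (p : A → Bool) {x xs} → any p xs ≡ false → x ∈ xs → p x ≡ false
any-false p none (here refl) = ∨-conicalˡ _ _ none
any-false p none (there x∈)  = any-false p (∨-conicalʳ _ _ none) x∈

∑-allFin-suc : ∀ n f → ∑ (allFin (suc n)) f ≡ f zero + ∑ (allFin n) (f ∘ suc)
∑-allFin-suc n f = cong (λ s → f zero + s)
  (trans (cong (λ is → ∑ is f) (sym (map-tabulate (λ i → i) suc))) (∑-map suc (allFin n) f))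

infix 4 _≡ᶠ_
_≡ᶠ_ : ∀ {n} → Fin n → Fin n → Bool
i ≡ᶠ j = does (i Fin.≟ j)

∑-≡ᶠ : ∀ {n} (j : Fin n) → ∑ (allFin n) (λ i → 𝟙 (i ≡ᶠ j)) ≤ 1
∑-≡ᶠ {suc n} zero = ≤-reflexive (trans (∑-allFin-suc n (λ i → 𝟙 (i ≡ᶠ zero)))
  (cong suc (trans (∑-const (allFin n) 0) (*-zeroʳ (length (allFin n))))))
∑-≡ᶠ {suc n} (suc j) = ≤-trans (≤-reflexive (∑-allFin-suc n (λ i → 𝟙 (i ≡ᶠ suc j)))) (∑-≡ᶠ j)

-- Product spaces

words : List A → ∀ n → List (Vec A n)
words xs zero    = [] ∷ []
words xs (suc n) = concatMap (λ x → map (x ∷_) (words xs n)) xs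

∑-words : ∀ (xs : List A) n f →
          ∑ (words xs (suc n)) f ≡ ∑ xs (λ x → ∑ (words xs n) (λ w → f (x ∷ w)))
∑-words xs n f = trans (∑-concatMap (λ x → map (x ∷_) (words xs n)) xs f)
  (∑-cong xs (λ x → ∑-map (x ∷_) (words xs n) f))

length-words-suc : ∀ (xs : List A) n → length (words xs (suc n)) ≡ length xs * length (words xs n)
length-words-suc xs n = trans (length-∑ (words xs (suc n))) (trans (∑-words xs n _)
  (trans (∑-const xs _) (cong (length xs *_) (sym (length-∑ (words xs n))))))

length-words : ∀ (xs : List A) n → length (words xs n) ≡ length xs ^ n
length-words xs zero    = refl
length-words xs (suc n) = trans (length-words-suc xs n) (cong (length xs *_) (length-words xs n))

allᵛ : ∀ {n} → (A → Bool) → Vec A n → Bool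
allᵛ p []       = true
allᵛ p (x ∷ xs) = p x ∧ allᵛ p xs

-- The letters of a uniform word are independent: splitting off the first letter factors the sum.
∑-allᵛ : ∀ (xs : List A) n p → ∑ (words xs n) (𝟙 ∘ allᵛ p) ≡ ∑ xs (𝟙 ∘ p) ^ n
∑-allᵛ xs zero    p = refl
∑-allᵛ xs (suc n) p = trans (∑-words xs n _)
  (trans (∑-cong xs (λ x → trans (∑-cong (words xs n) (λ w → 𝟙-∧ (p x) (allᵛ p w)))
                          (trans (∑-*ˡ (words xs n) (𝟙 (p x)) _)
                                 (cong (𝟙 (p x) *_) (∑-allᵛ xs n p)))))
         (∑-*ʳ xs (∑ xs (𝟙 ∘ p) ^ n) (𝟙 ∘ p)))

allᵛ-cong : ∀ {n} (p : A → Bool) (v w : Vec A n) →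
            (∀ i → p (lookup v i) ≡ p (lookup w i)) → allᵛ p v ≡ allᵛ p w
allᵛ-cong p []      []      eq = refl
allᵛ-cong p (_ ∷ v) (_ ∷ w) eq = cong₂ _∧_ (eq zero) (allᵛ-cong p v w (eq ∘ suc))

allᵛ-false : ∀ {n} (p : A → Bool) (v : Vec A n) → allᵛ p v ≡ false → ∃[ i ] p (lookup v i) ≡ false
allᵛ-false p (x ∷ v) notAll with p x in eq
... | false = zero , eq
... | true  with allᵛ-false p v notAll
...   | i , pᵢ = suc i , pᵢ

-- If one of the two positions is the head, fix the tail: at most one of the `b` head letters equals
-- the other entry. If both lie in the tail, the head letter only multiplies both sides by `b`.
∑-coincide : ∀ b n (i j : Fin n) → i ≢ j →
  b * ∑ (words (allFin b) n) (λ w → 𝟙 (lookup w i ≡ᶠ lookup w j)) ≤ length (words (allFin b) n)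
∑-coincide b (suc n) zero zero i≢j = contradiction refl i≢j
∑-coincide b (suc n) zero (suc j) _ = begin
  b * ∑ (words (allFin b) (suc n)) _
    ≡⟨ cong (b *_) (trans (∑-words (allFin b) n _) (∑-swap (allFin b) (words (allFin b) n) _)) ⟩
  b * ∑ (words (allFin b) n) (λ w → ∑ (allFin b) (λ a → 𝟙 (a ≡ᶠ lookup w j)))
    ≤⟨ *-monoʳ-≤ b (∑-mono (words (allFin b) n) (λ w → ∑-≡ᶠ (lookup w j))) ⟩
  b * ∑ (words (allFin b) n) (λ _ → 1)
    ≡⟨ cong₂ _*_ (sym (length-allFin b)) (sym (length-∑ (words (allFin b) n))) ⟩
  length (allFin b) * length (words (allFin b) n)
    ≡⟨ sym (length-words-suc (allFin b) n) ⟩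
  length (words (allFin b) (suc n)) ∎
  where
  open ≤-Reasoning
  length-allFin : ∀ b → length (allFin b) ≡ b
  length-allFin b = length-tabulate (λ i → i)
∑-coincide b (suc n) (suc i) zero i≢j = begin
  b * ∑ (words (allFin b) (suc n)) (λ w → 𝟙 (lookup w (suc i) ≡ᶠ lookup w zero))
    ≡⟨ cong (b *_) (∑-cong (words (allFin b) (suc n)) (λ w → cong 𝟙 (≡ᶠ-sym (lookup w (suc i)) (lookup w zero)))) ⟩
  b * ∑ (words (allFin b) (suc n)) (λ w → 𝟙 (lookup w zero ≡ᶠ lookup w (suc i)))
    ≤⟨ ∑-coincide b (suc n) zero (suc i) (i≢j ∘ sym) ⟩
  length (words (allFin b) (suc n)) ∎
  where
  open ≤-Reasoning
  ≡ᶠ-sym : ∀ {b} (i j : Fin b) → (i ≡ᶠ j) ≡ (j ≡ᶠ i)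
  ≡ᶠ-sym i j with i Fin.≟ j | j Fin.≟ i
  ... | yes _   | yes _   = refl
  ... | no _    | no _    = refl
  ... | yes i≡j | no j≢i  = contradiction (sym i≡j) j≢i
  ... | no i≢j  | yes j≡i = contradiction (sym j≡i) i≢j
∑-coincide b (suc n) (suc i) (suc j) i≢j = begin
  b * ∑ (words (allFin b) (suc n)) _
    ≡⟨ cong (b *_) (trans (∑-words (allFin b) n _) (∑-const (allFin b) _)) ⟩
  b * (length (allFin b) * c)
    ≡⟨ x∙yz≈y∙xz *-commutativeSemigroup b (length (allFin b)) c ⟩
  length (allFin b) * (b * c)
    ≤⟨ *-monoʳ-≤ (length (allFin b)) (∑-coincide b n i j (i≢j ∘ cong suc)) ⟩
  length (allFin b) * length (words (allFin b) n)
    ≡⟨ sym (length-words-suc (allFin b) n) ⟩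
  length (words (allFin b) (suc n)) ∎
  where
  open ≤-Reasoning
  c = ∑ (words (allFin b) n) (λ w → 𝟙 (lookup w i ≡ᶠ lookup w j))

-- Independence on product spaces

Respects : (A → A → Set) → (A → B) → Set
Respects R f = ∀ x y → R x y → f x ≡ f y

-- This is E[fg] = E[f] E[g] for the uniform distribution on `xs`, with denominators cleared.
-- `Respects R f` plays the part of measurability: `f` depends only on what `R` fixes.
Uncorrelated : List A → (A → A → Set) → (A → A → Set) → Set
Uncorrelated xs R Q = ∀ f g → Respects R f → Respects Q g →
                     ∑ xs (λ x → f x * g x) * length xs ≡ ∑ xs f * ∑ xs g

uncorrelated-sym : ∀ {xs : List A} {R Q} → Uncorrelated xs R Q → Uncorrelated xs Q R
uncorrelated-sym {xs = xs} ind f g f-resp g-resp =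
  trans (cong (_* length xs) (∑-cong xs (λ x → *-comm (f x) (g x))))
        (trans (ind g f g-resp f-resp) (*-comm (∑ xs g) (∑ xs f)))

-- A function that respects a total relation is constant, and a constant factor comes out of the
-- sum.
uncorrelated-const : ∀ (xs : List A) {R Q} → (∀ x y → Q x y) → Uncorrelated xs R Q
uncorrelated-const []       total f g _ _ = refl
uncorrelated-const xs@(x ∷ _) total f g _ g-resp =
  trans (cong (_* length xs) (trans (∑-cong xs (λ y → cong (f y *_) (g≡ y))) (∑-*ʳ xs (g x) f)))
  (trans (*-assoc (∑ xs f) (g x) (length xs))
         (cong (∑ xs f *_) (trans (*-comm (g x) (length xs))
                                  (sym (trans (∑-cong xs g≡) (∑-const xs (g x)))))))
  where
  g≡ : ∀ y → g y ≡ g x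
  g≡ y = g-resp y x (total y x)

Pointwise : ∀ {n} → (Fin n → A → A → Set) → Vec A n → Vec A n → Set
Pointwise R v w = ∀ i → R i (lookup v i) (lookup w i)

Pointwise-∷ : ∀ {n} {R : Fin (suc n) → A → A → Set} {x y v w} →
  R zero x y → Pointwise (R ∘ suc) v w → Pointwise R (x ∷ v) (y ∷ w)
Pointwise-∷ r rs zero    = r
Pointwise-∷ r rs (suc i) = rs i

-- Induction on the length. For each fixed head letter the induction hypothesis factors the sum over
-- tails; the two tail sums, as functions of the head, respect `R zero` and `Q zero`, so `ind zero`
-- factors the sum over heads. Reflexivity allows the head or the tail to vary alone.
uncorrelated-words : ∀ (xs : List A) n {R Q : Fin n → A → A → Set} →
  (∀ i x → R i x x) → (∀ i x → Q i x x) → (∀ i → Uncorrelated xs (R i) (Q i)) →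
  Uncorrelated (words xs n) (Pointwise R) (Pointwise Q)
uncorrelated-words xs zero    R-refl Q-refl ind f g _ _ =
  trans (*-identityʳ _) (trans (+-identityʳ _)
    (sym (cong₂ _*_ (+-identityʳ (f [])) (+-identityʳ (g [])))))
uncorrelated-words xs (suc n) {R} {Q} R-refl Q-refl ind f g f-resp g-resp = begin
  ∑ (words xs (suc n)) (λ w → f w * g w) * length (words xs (suc n))
    ≡⟨ cong₂ _*_ (∑-words xs n _) (trans (length-words-suc xs n) (*-comm (length xs) (length W))) ⟩
  ∑ xs (λ x → ∑ W (λ w → f (x ∷ w) * g (x ∷ w))) * (length W * length xs)
    ≡⟨ sym (*-assoc (∑ xs (λ x → ∑ W (λ w → f (x ∷ w) * g (x ∷ w)))) (length W) (length xs)) ⟩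
  ∑ xs (λ x → ∑ W (λ w → f (x ∷ w) * g (x ∷ w))) * length W * length xs
    ≡⟨ cong (_* length xs) (sym (∑-*ʳ xs (length W) _)) ⟩
  ∑ xs (λ x → ∑ W (λ w → f (x ∷ w) * g (x ∷ w)) * length W) * length xs
    ≡⟨ cong (_* length xs) (∑-cong xs (λ x →
         uncorrelated-words xs n (R-refl ∘ suc) (Q-refl ∘ suc) (ind ∘ suc) _ _
           (λ v w r → f-resp _ _ (Pointwise-∷ {R = R} (R-refl zero x) r))
           (λ v w q → g-resp _ _ (Pointwise-∷ {R = Q} (Q-refl zero x) q)))) ⟩
  ∑ xs (λ x → ∑ W (f ∘ (x ∷_)) * ∑ W (g ∘ (x ∷_))) * length xs
    ≡⟨ ind zero _ _
         (λ x y r → ∑-cong W (λ w → f-resp _ _ (Pointwise-∷ {R = R} r (λ i → R-refl (suc i) (lookup w i)))))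
         (λ x y q → ∑-cong W (λ w → g-resp _ _ (Pointwise-∷ {R = Q} q (λ i → Q-refl (suc i) (lookup w i))))) ⟩
  ∑ xs (λ x → ∑ W (f ∘ (x ∷_))) * ∑ xs (λ x → ∑ W (g ∘ (x ∷_)))
    ≡⟨ cong₂ _*_ (sym (∑-words xs n f)) (sym (∑-words xs n g)) ⟩
  ∑ (words xs (suc n)) f * ∑ (words xs (suc n)) g ∎
  where
  open ≡-Reasoning
  W = words xs n

-- Splitting a list by a test, and the local lemma

filterᵇ-all : ∀ (p : A → Bool) xs → All (λ x → p x ≡ true) (filterᵇ p xs)
filterᵇ-all p []       = []
filterᵇ-all p (x ∷ xs) with p x in eq
... | true  = eq ∷ filterᵇ-all p xs
... | false = filterᵇ-all p xs

∑-filterᵇ-≤ : ∀ (p : A → Bool) xs f → ∑ (filterᵇ p xs) f ≤ ∑ xs f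
∑-filterᵇ-≤ p []       f = z≤n
∑-filterᵇ-≤ p (x ∷ xs) f with p x
... | true  = +-monoʳ-≤ (f x) (∑-filterᵇ-≤ p xs f)
... | false = ≤-trans (∑-filterᵇ-≤ p xs f) (m≤n+m _ (f x))

length-filterᵇ-split : ∀ (p : A → Bool) xs →
  length (filterᵇ p xs) + length (filterᵇ (not ∘ p) xs) ≡ length xs
length-filterᵇ-split p []       = refl
length-filterᵇ-split p (x ∷ xs) with p x
... | true  = cong suc (length-filterᵇ-split p xs)
... | false = trans (+-suc _ _) (cong suc (length-filterᵇ-split p xs))

-- The symmetric Lovász local lemma for the uniform distribution on Ωs, with all
-- probabilities 1/q multiplied out into counts.
module LocalLemma {Ω E : Set} (Ωs : List Ω) (bad : E → Ω → Bool) (dep : E → E → Bool) where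

  avoid : List E → Ω → ℕ
  avoid []      ω = 1
  avoid (e ∷ S) ω = 𝟙 (not (bad e ω)) * avoid S ω

  near far : E → List E → List E
  near e = filterᵇ (dep e)
  far  e = filterᵇ (not ∘ dep e)

  avoiding : List E → ℕ
  avoiding S = ∑ Ωs (avoid S)

  -- The numerator of the conditional probability of `e` given that `S` is avoided; the denominator
  -- is `avoiding S`.
  hitting : E → List E → ℕ
  hitting e S = ∑ Ωs (λ ω → 𝟙 (bad e ω) * avoid S ω)

  avoid-far : ∀ e S ω → avoid S ω ≤ avoid (far e S) ω
  avoid-far e []      ω = ≤-refl
  avoid-far e (f ∷ S) ω with dep e f
  ... | true  = ≤-trans (*-mono-≤ (𝟙≤1 (not (bad f ω))) (avoid-far e S ω)) (≤-reflexive (*-identityˡ _))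
  ... | false = *-monoʳ-≤ (𝟙 (not (bad f ω))) (avoid-far e S ω)

  -- An outcome that avoids the far events either avoids the near ones as well or lies in some near
  -- `f`, which then contributes a summand 1.
  avoid-cover : ∀ e S ω →
    avoid (far e S) ω ≤ avoid S ω + ∑ (near e S) (λ f → 𝟙 (bad f ω) * avoid (far e S) ω)
  avoid-cover e []      ω = ≤-refl
  avoid-cover e (f ∷ S) ω with dep e f
  ... | true with bad f ω
  ...   | true  = ≤-trans (≤-reflexive (sym (+-identityʳ _))) (m≤m+n _ _)
  ...   | false = ≤-trans (avoid-cover e S ω) (+-monoˡ-≤ _ (≤-reflexive (sym (*-identityˡ (avoid S ω)))))
  avoid-cover e (f ∷ S) ω | false with bad f ω
  ... | true  = z≤n
  ... | false = begin
    1 * avoid (far e S) ω ≡⟨ *-identityˡ _ ⟩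
    avoid (far e S) ω     ≤⟨ avoid-cover e S ω ⟩
    avoid S ω + ∑ (near e S) (λ f → 𝟙 (bad f ω) * avoid (far e S) ω)
      ≡⟨ cong₂ _+_ (sym (*-identityˡ _))
           (∑-cong (near e S) (λ f → cong (𝟙 (bad f ω) *_) (sym (*-identityˡ _)))) ⟩
    1 * avoid S ω + ∑ (near e S) (λ f → 𝟙 (bad f ω) * (1 * avoid (far e S) ω)) ∎
    where open ≤-Reasoning

  avoid-positive : ∀ {S e ω} → e ∈ S → 0 < avoid S ω → bad e ω ≡ false
  avoid-positive {f ∷ S} {ω = ω} f∈S 0<a with bad f ω in eq
  avoid-positive {f ∷ S} (here refl) 0<a | false = eq
  avoid-positive {f ∷ S} (there e∈S) 0<a | false =
    avoid-positive e∈S (subst (0 <_) (*-identityˡ _) 0<a)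

  hitting-cover : ∀ e S → avoiding (far e S) ≤ avoiding S + ∑ (near e S) (λ f → hitting f (far e S))
  hitting-cover e S = begin
    avoiding (far e S)
      ≤⟨ ∑-mono Ωs (avoid-cover e S) ⟩
    ∑ Ωs (λ ω → avoid S ω + ∑ (near e S) (λ f → 𝟙 (bad f ω) * avoid (far e S) ω))
      ≡⟨ ∑-+ Ωs (avoid S) _ ⟩
    avoiding S + ∑ Ωs (λ ω → ∑ (near e S) (λ f → 𝟙 (bad f ω) * avoid (far e S) ω))
      ≡⟨ cong (λ s → avoiding S + s) (∑-swap Ωs (near e S) (λ ω f → 𝟙 (bad f ω) * avoid (far e S) ω)) ⟩
    avoiding S + ∑ (near e S) (λ f → hitting f (far e S)) ∎
    where open ≤-Reasoning

  module _ (q d : ℕ)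
    -- Mutual independence: conditioning on the avoidance of events not dependent on `e` leaves the
    -- probability of `e` unchanged.
    (indep : ∀ e S → All (λ f → not (dep e f) ≡ true) S →
             hitting e S * length Ωs ≡ ∑ Ωs (𝟙 ∘ bad e) * avoiding S)
    (rare  : ∀ e → q * ∑ Ωs (𝟙 ∘ bad e) ≤ length Ωs)
    (0<∣Ω∣ : 0 < length Ωs) (4d≤q : 4 * d ≤ q) (2<q : 2 < q)
    where

    Sparse : List E → Set
    Sparse S = ∀ e → ∑ S (𝟙 ∘ dep e) ≤ d

    -- By `indep` the conditional probability of `e` equals the unconditional one, which `rare`
    -- bounds by 1/q.
    far-rare : ∀ e S → q * hitting e (far e S) ≤ avoiding (far e S)
    far-rare e S = *-cancelʳ-≤ _ _ (length Ωs) {{>-nonZero 0<∣Ω∣}} (begin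
      q * hitting e F * length Ωs            ≡⟨ *-assoc q (hitting e F) (length Ωs) ⟩
      q * (hitting e F * length Ωs)          ≡⟨ cong (q *_) (indep e F (filterᵇ-all (not ∘ dep e) S)) ⟩
      q * (∑ Ωs (𝟙 ∘ bad e) * avoiding F)    ≡⟨ sym (*-assoc q _ (avoiding F)) ⟩
      q * ∑ Ωs (𝟙 ∘ bad e) * avoiding F      ≤⟨ *-monoˡ-≤ (avoiding F) (rare e) ⟩
      length Ωs * avoiding F                 ≡⟨ *-comm (length Ωs) (avoiding F) ⟩
      avoiding F * length Ωs                 ∎)
      where
      open ≤-Reasoning
      F = far e S

    -- Given that the far events are avoided, each of the at most `d` near events has probability at
    -- most 2/q. Together they take at most 2d/q ≤ 1/2, so at least half of the outcomes also avoid
    -- the near events.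
    far-halves : ∀ e S → Sparse S → (∀ f → q * hitting f (far e S) ≤ 2 * avoiding (far e S)) →
                 avoiding (far e S) ≤ 2 * avoiding S
    far-halves e S sparse small = +-cancelʳ-≤ N _ _ (begin
      N + N           ≡⟨ cong (λ s → N + s) (sym (+-identityʳ N)) ⟩
      2 * N           ≤⟨ *-monoʳ-≤ 2 (hitting-cover e S) ⟩
      2 * (avoiding S + T)      ≡⟨ *-distribˡ-+ 2 (avoiding S) T ⟩
      2 * avoiding S + 2 * T    ≤⟨ +-monoʳ-≤ (2 * avoiding S) 2T≤N ⟩
      2 * avoiding S + N        ∎)
      where
      open ≤-Reasoning
      N = avoiding (far e S)
      T = ∑ (near e S) (λ f → hitting f (far e S))
      2T≤N : 2 * T ≤ N
      2T≤N = *-cancelˡ-≤ q {{>-nonZero (≤-trans z<s 2<q)}} (begin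
        q * (2 * T)       ≡⟨ swap q T ⟩
        2 * (q * T)       ≡⟨ cong (2 *_) (sym (∑-*ˡ (near e S) q _)) ⟩
        2 * ∑ (near e S) (λ f → q * hitting f (far e S))
                          ≤⟨ *-monoʳ-≤ 2 (∑-mono (near e S) small) ⟩
        2 * ∑ (near e S) (λ _ → 2 * N)
                          ≡⟨ cong (2 *_) (∑-const (near e S) (2 * N)) ⟩
        2 * (length (near e S) * (2 * N))
                          ≤⟨ *-monoʳ-≤ 2 (*-monoˡ-≤ (2 * N) (≤-trans (≤-reflexive (length-filter (T? ∘ dep e) S)) (sparse e))) ⟩
        2 * (d * (2 * N)) ≡⟨ regroup d N ⟩
        4 * d * N         ≤⟨ *-monoˡ-≤ N 4d≤q ⟩
        q * N             ∎)
        where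
        swap : ∀ q T → q * (2 * T) ≡ 2 * (q * T)
        swap = solve-∀
        regroup : ∀ d N → 2 * (d * (2 * N)) ≡ 4 * d * N
        regroup = solve-∀

    -- Given that all of S is avoided, every event has probability at most 2/q.
    hitting-small : ∀ n S → length S ≤ n → Sparse S → ∀ e → q * hitting e S ≤ 2 * avoiding S
    hitting-small n S ∣S∣≤n sparse e = begin
      -- Conditioning on fewer events only enlarges the numerator; the loss in the denominator is a
      -- factor of at most 2, by `halves`.
      q * hitting e S         ≤⟨ *-monoʳ-≤ q (∑-mono Ωs (λ ω → *-monoʳ-≤ (𝟙 (bad e ω)) (avoid-far e S ω))) ⟩
      q * hitting e (far e S) ≤⟨ far-rare e S ⟩
      avoiding (far e S)      ≤⟨ halves n ∣S∣≤n ⟩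
      2 * avoiding S          ∎
      where
      open ≤-Reasoning
      far-shorter : ∀ {f fs} → near e S ≡ f ∷ fs → length (far e S) < length S
      far-shorter {fs = fs} eq = begin
        suc (length (far e S))                  ≤⟨ s≤s (m≤n+m (length (far e S)) (length fs)) ⟩
        suc (length fs) + length (far e S)      ≡⟨ cong (λ l → length l + length (far e S)) (sym eq) ⟩
        length (near e S) + length (far e S)    ≡⟨ length-filterᵇ-split (dep e) S ⟩
        length S                                ∎
      -- Without near events the union in `hitting-cover` is empty. With at least one, the far list
      -- is strictly shorter than `S`, so the induction on the length bound supplies the hypothesis
      -- of `far-halves`.
      halves : ∀ n → length S ≤ n → avoiding (far e S) ≤ 2 * avoiding S
      halves n ∣S∣≤n with near e S in eq
      ... | [] = ≤-trans (hitting-cover e S) (+-monoʳ-≤ (avoiding S)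
        (subst (λ fs → ∑ fs (λ f → hitting f (far e S)) ≤ avoiding S + 0) (sym eq) z≤n))
      halves zero ∣S∣≤0 | _ ∷ _ = contradiction (≤-trans (far-shorter eq) ∣S∣≤0) λ ()
      halves (suc n) ∣S∣≤n | _ ∷ _ = far-halves e S sparse
        (hitting-small n (far e S) (s≤s⁻¹ (≤-trans (far-shorter eq) ∣S∣≤n))
          (λ f → ≤-trans (∑-filterᵇ-≤ (not ∘ dep e) S (𝟙 ∘ dep f)) (sparse f)))

    -- If no outcome avoided `e ∷ S`, every outcome avoiding `S` would hit `e`. Then `hitting-small`
    -- would give q ≤ 2, as `avoiding S` is positive by induction.
    avoiding-positive : ∀ S → Sparse S → 0 < avoiding S
    avoiding-positive []      sparse = subst (0 <_) (length-∑ Ωs) 0<∣Ω∣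
    avoiding-positive (e ∷ S) sparse = n≢0⇒n>0 λ N≡0 → <⇒≱ 2<q
      (*-cancelʳ-≤ q 2 (avoiding S) {{>-nonZero (avoiding-positive S sparse′)}}
        (subst (λ h → q * h ≤ 2 * avoiding S)
          (trans (cong (_+ hitting e S) (sym N≡0)) split)
          (hitting-small (length S) S ≤-refl sparse′ e)))
      where
      sparse′ : Sparse S
      sparse′ f = ≤-trans (m≤n+m _ (𝟙 (dep f e))) (sparse f)
      split : avoiding (e ∷ S) + hitting e S ≡ avoiding S
      split = trans (sym (∑-+ Ωs (avoid (e ∷ S)) _)) (∑-cong Ωs (λ ω →
        trans (sym (*-distribʳ-+ (avoid S ω) (𝟙 (not (bad e ω))) (𝟙 (bad e ω))))
              (trans (cong (_* avoid S ω) (𝟙-not (bad e ω))) (*-identityˡ _))))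

    localLemma : ∀ S → Sparse S → ∃[ ω ] ∀ {e} → e ∈ S → bad e ω ≡ false
    localLemma S sparse with ∑-positive Ωs (avoid S) (avoiding-positive S sparse)
    ... | ω , 0<a = ω , λ e∈S → avoid-positive {S = S} e∈S 0<a

-- Numerical bounds

/-+ : ∀ a b d → + a / suc d ℚ.+ + b / suc d ≡ + (a + b) / suc d
/-+ a zero    d = trans (cong (λ p → + a / suc d ℚ.+ p) (ℚ.≤-antisym (/-mono 0 d 0 0 z≤n) (/-mono 0 0 0 d z≤n)))
  (trans (ℚ.+-identityʳ (+ a / suc d)) (cong (λ c → + c / suc d) (sym (+-identityʳ a))))
/-+ a (suc b) d = trans (cong (λ p → + a / suc d ℚ.+ p) (sym (/-suc b d)))
  (trans (sym (ℚ.+-assoc (+ a / suc d) (+ b / suc d) (+ 1 / suc d)))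
  (trans (cong (λ p → p ℚ.+ + 1 / suc d) (/-+ a b d))
  (trans (/-suc (a + b) d) (cong (λ c → + c / suc d) (sym (+-suc a b))))))

/-cancel-≤ : ∀ a b c d → + a / suc b ℚ.≤ + c / suc d → a * suc d ≤ c * suc b
/-cancel-≤ a b c d a/b≤c/d = ℤ.drop‿+≤+ (subst₂ ℤ._≤_ (sym (ℤ.pos-* a (suc d))) (sym (ℤ.pos-* c (suc b)))
  (ℚᵘ.drop-*≤* (ℚᵘ.≤-respˡ-≃ (toℚᵘ-/ (+ a) b) (ℚᵘ.≤-respʳ-≃ (toℚᵘ-/ (+ c) d) (ℚ.toℚᵘ-mono-≤ a/b≤c/d)))))

/-scale : ∀ m d a → (+ (suc d * m) / 1) ℚ.* (+ a / suc d) ≡ + (m * a) / 1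
/-scale m d a = ℚ.toℚᵘ-injective
  (ℚᵘ.≃-trans (ℚ.toℚᵘ-homo-* (+ (suc d * m) / 1) (+ a / suc d))
  (ℚᵘ.≃-trans (ℚᵘ.*-cong (toℚᵘ-/ (+ (suc d * m)) 0) (toℚᵘ-/ (+ a) d))
  (ℚᵘ.≃-trans (*≡* eq) (ℚᵘ.≃-sym (toℚᵘ-/ (+ (m * a)) 0)))))
  where
  rearrange : ∀ D m a → D * m * a * 1 ≡ m * a * (1 * D)
  rearrange = solve-∀
  eq : (+ (suc d * m)) ℤ.* (+ a) ℤ.* (+ 1) ≡ (+ (m * a)) ℤ.* (+ (1 * suc d))
  eq = trans (cong (ℤ._* + 1) (sym (ℤ.pos-* (suc d * m) a)))
       (trans (sym (ℤ.pos-* (suc d * m * a) 1))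
       (trans (cong +_ (rearrange (suc d) m a)) (ℤ.pos-* (m * a) (1 * suc d))))

H-mono : ∀ a m n → m ≤ n → H a m ℚ.≤ H a n
H-mono a m n m≤n = subst (λ l → H a m ℚ.≤ H a l) (m+[n∸m]≡n m≤n)
  (ℚ.≤-trans (ℚ.≤-reflexive (sym (ℚ.+-identityʳ (H a m))))
  (ℚ.≤-trans (ℚ.+-monoʳ-≤ (H a m) (ℚ.≤-trans (/-mono 0 0 (n ∸ m) (a + m + (n ∸ m)) z≤n)
                                               (H-lower (a + m) (n ∸ m) (a + m + (n ∸ m)) (n≤1+n _))))
             (ℚ.≤-reflexive (sym (H-split a m (n ∸ m))))))

-- Doubling the range adds at least 1/2 > 12/27.
H-2^ : ∀ s m → suc m ≡ 2 ^ (6 + s) → + (100 + s * 12) / 27 ℚ.≤ H 1 m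
-- By evaluation: 1/2 + ⋯ + 1/64 is about 3.744 and 100/27 about 3.704. As 100 = 28 + 12 · 6, the
-- parameter `s` corresponds to l = 6 + s.
H-2^ zero    .63 refl = toWitness {a? = (+ 100 / 27) ℚ.≤? H 1 63} tt
H-2^ (suc s) m   eq   = subst (λ l → + (100 + suc s * 12) / 27 ℚ.≤ H 1 l) (suc-injective m≡)
  (ℚ.≤-trans (ℚ.≤-reflexive (trans (cong (λ c → + c / 27) (shift s)) (sym (/-+ (100 + s * 12) 12 26))))
  (ℚ.≤-trans (ℚ.+-mono-≤ (H-2^ s h 1+h≡)
    (ℚ.≤-trans (/-mono 12 26 (suc h) (h + suc h) (≤-trans (m≤m+n (12 * suc (h + suc h)) (3 * suc h)) (≤-reflexive (fits h))))
               (H-lower (suc h) (suc h) (h + suc h) ≤-refl)))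
  (ℚ.≤-reflexive (sym (H-split 1 h (suc h))))))
  where
  h = pred (2 ^ (6 + s))
  1+h≡ : suc h ≡ 2 ^ (6 + s)
  1+h≡ = suc-pred (2 ^ (6 + s)) {{m^n≢0 2 (6 + s)}}
  m≡ : suc (h + suc h) ≡ suc m
  m≡ = trans (cong₂ _+_ 1+h≡ (trans 1+h≡ (sym (+-identityʳ _)))) (sym eq)
  shift : ∀ s → 100 + suc s * 12 ≡ 100 + s * 12 + 12
  shift = solve-∀
  fits : ∀ h → 12 * suc (h + suc h) + 3 * suc h ≡ suc h * 27
  fits = solve-∀

log₂-bracket : ∀ n → 0 < n → ∃[ l ] (2 ^ l ≤ n × n < 2 ^ suc l)
log₂-bracket (suc zero)    _ = 0 , ≤-refl , ≤-refl
log₂-bracket (suc (suc n)) _ with log₂-bracket (suc n) z<s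
... | l , lower , upper with suc (suc n) <? 2 ^ suc l
...   | yes below = l , m≤n⇒m≤1+n lower , below
...   | no above  = suc l , ≮⇒≥ above ,
        ≤-<-trans upper (^-monoʳ-< 2 (s≤s (s≤s z≤n)) (n<1+n (suc l)))

-- With mesh 1 the Riemann sum `lnSum n 0` is 1/2 + ⋯ + 1/n. The bound n < 2^(l+1) rules out l ≤ 4;
-- for l ≥ 6 the sum is cut off at 2^l.
lnSum-lower : ∀ n l → 41 ≤ n → 2 ^ l ≤ n → n < 2 ^ suc l → + (28 + l * 12) / 27 ℚ.≤ lnSum n 0
lnSum-lower n 0 41≤n _ n< = contradiction (≤-trans n< (m≤m+n 2 39)) (≤⇒≯ 41≤n)
lnSum-lower n 1 41≤n _ n< = contradiction (≤-trans n< (m≤m+n 4 37)) (≤⇒≯ 41≤n)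
lnSum-lower n 2 41≤n _ n< = contradiction (≤-trans n< (m≤m+n 8 33)) (≤⇒≯ 41≤n)
lnSum-lower n 3 41≤n _ n< = contradiction (≤-trans n< (m≤m+n 16 25)) (≤⇒≯ 41≤n)
lnSum-lower n 4 41≤n _ n< = contradiction (≤-trans n< (m≤m+n 32 9)) (≤⇒≯ 41≤n)
-- Here 28 + 12 · 5 = 88, and 1/2 + ⋯ + 1/41 is about 3.303 while 88/27 is about 3.259.
lnSum-lower n 5 41≤n _ _  = ℚ.≤-trans (toWitness {a? = (+ 88 / 27) ℚ.≤? H 1 40} tt)
  (H-mono 1 40 ((n ∸ 1) * 1) (≤-trans (∸-monoˡ-≤ 1 41≤n) (≤-reflexive (sym (*-identityʳ (n ∸ 1))))))
lnSum-lower n (suc (suc (suc (suc (suc (suc s)))))) _ 2^l≤n _ =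
  ℚ.≤-trans (H-2^ s (2 ^ (6 + s) ∸ 1) (suc-pred (2 ^ (6 + s)) {{m^n≢0 2 (6 + s)}}))
  (H-mono 1 (2 ^ (6 + s) ∸ 1) ((n ∸ 1) * 1) (≤-trans (∸-monoˡ-≤ 1 2^l≤n) (≤-reflexive (sym (*-identityʳ (n ∸ 1))))))

-- The sums `lnSum Δ N` increase with N, so the first one bounds every later term from below. Taking
-- ε = 1/2 in the order on the reals gives Δa ≤ k + 1/2, and both sides of the claim are integers.
ln-ceiling-lower : ∀ Δ k a → + a / 27 ℚ.≤ lnSum Δ 0 → (27 * Δ) · ln Δ ≤ᴿ fromℤ (+ k) → Δ * a ≤ k
ln-ceiling-lower zero    k a _ _ = z≤n
ln-ceiling-lower Δ@(suc p) k a a≤ x≤k with x≤k (+ 1 / 2) (toWitness {a? = ℚ.0ℚ ℚ.<? + 1 / 2} tt)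
... | N , below = half (/-cancel-≤ (Δ * a) 0 (k * 2 + 1) 1 (begin
  + (Δ * a) / 1                               ≡⟨ sym (/-scale Δ 26 a) ⟩
  (+ (27 * Δ) / 1) ℚ.* (+ a / 27)             ≤⟨ ℚ.*-monoˡ-≤-nonNeg (+ (27 * Δ) / 1) {{unit-nonNeg (27 * Δ) 1}} (ℚ.≤-trans a≤ A0≤AN) ⟩
  (+ (27 * Δ) / 1) ℚ.* lnSum Δ N              ≤⟨ below N ≤-refl ⟩
  + k / 1 ℚ.+ + 1 / 2                         ≡⟨ cong (ℚ._+ + 1 / 2) (ℚ.≤-antisym
                                                    (/-mono k 0 (k * 2) 1 (≤-reflexive (sym (*-identityʳ _))))
                                                    (/-mono (k * 2) 1 k 0 (≤-reflexive (*-identityʳ _)))) ⟩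
  + (k * 2) / 2 ℚ.+ + 1 / 2                   ≡⟨ /-+ (k * 2) 1 1 ⟩
  + (k * 2 + 1) / 2                           ∎))
  where
  open ℚ.≤-Reasoning
  A0≤AN : lnSum Δ 0 ℚ.≤ lnSum Δ N
  A0≤AN = subst (λ j → lnSum Δ 0 ℚ.≤ lnSum Δ j) (+-identityʳ N) (A-mono p 0 N)
  half : Δ * a * 2 ≤ (k * 2 + 1) * 1 → Δ * a ≤ k
  half h = s≤s⁻¹ (*-cancelʳ-< 2 (Δ * a) (suc k) (s≤s (≤-trans h
    (≤-reflexive (trans (*-identityʳ _) (+-comm (k * 2) 1))))))

-- Separating the neighbourhoods of adjacent vertices

-- Asymmetric in the two ends: only the label of `x` will enter the colour of the edge, so only that
-- label has to be unrepeated nearby.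
Separates : ∀ (G : Graph) {b} → (Graph.Vertex G → Fin b) → Graph.Vertex G → Graph.Vertex G → Set
Separates G c y x = ∀ z → y ~ z ⊎ x ~ z → z ≢ x → c z ≢ c x
  where open Graph G

module Separation (G : Graph) (Δ t : ℕ) (degree≤Δ : ∀ v → Graph.degree G v ≤ Δ)
  (0<Δ : 0 < Δ) (Δ³≤2^t : 4 * (2 * Δ * (2 * (Δ * Δ))) ≤ 2 ^ t) where

  open Graph G

  vertices : List Vertex
  vertices = allFin order

  pairs : List (Vertex × Vertex)
  pairs = cartesianProduct vertices vertices

  adj : Vertex → Vertex → Bool
  adj u v = does (u ~? v)

  adj-sym : ∀ u v → adj u v ≡ adj v u
  adj-sym u v with u ~? v
  ... | yes u~v = sym (dec-true (v ~? u) (~-sym u~v))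
  ... | no  u≁v = sym (dec-false (v ~? u) (u≁v ∘ ~-sym))

  ∑-adj : ∀ v → ∑ vertices (λ u → 𝟙 (adj v u)) ≤ Δ
  ∑-adj v = ≤-trans (≤-reflexive (sym (length-filter (v ~?_) vertices))) (degree≤Δ v)

  ∑-adj′ : ∀ v → ∑ vertices (λ u → 𝟙 (adj u v)) ≤ Δ
  ∑-adj′ v = ≤-trans (≤-reflexive (∑-cong vertices (λ u → cong 𝟙 (adj-sym u v)))) (∑-adj v)

  -- Events are indexed by all ordered pairs of vertices; the guard `adj y x` gives non-adjacent
  -- pairs an empty scope, so they do not add to the dependency count.
  scope : Vertex × Vertex → Vertex → Bool
  scope (y , x) z = adj y x ∧ (adj y z ∨ adj x z)

  ∑-scope : ∀ e → ∑ vertices (𝟙 ∘ scope e) ≤ 2 * Δ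
  ∑-scope (y , x) = begin
    ∑ vertices (𝟙 ∘ scope (y , x))
      ≤⟨ ∑-mono vertices (λ z → ≤-trans (𝟙-∧-≤ʳ (adj y x) (adj y z ∨ adj x z)) (𝟙-∨ (adj y z) (adj x z))) ⟩
    ∑ vertices (λ z → 𝟙 (adj y z) + 𝟙 (adj x z))
      ≡⟨ ∑-+ vertices _ _ ⟩
    ∑ vertices (λ z → 𝟙 (adj y z)) + ∑ vertices (λ z → 𝟙 (adj x z))
      ≤⟨ +-mono-≤ (∑-adj y) (∑-adj x) ⟩
    Δ + Δ
      ≡⟨ cong (λ s → Δ + s) (sym (+-identityʳ Δ)) ⟩
    2 * Δ ∎
    where open ≤-Reasoning

  -- A pair with `z` in its scope is an arc one of whose ends is adjacent to `z`. For either end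
  -- there are at most Δ choices, and then at most Δ for the other end.
  ∑-scope⁻¹ : ∀ z → ∑ pairs (λ e → 𝟙 (scope e z)) ≤ 2 * (Δ * Δ)
  ∑-scope⁻¹ z = begin
    ∑ pairs (λ e → 𝟙 (scope e z))
      ≡⟨ ∑-cartesianProduct vertices vertices _ ⟩
    ∑ vertices (λ y → ∑ vertices (λ x → 𝟙 (scope (y , x) z)))
      ≤⟨ ∑-mono vertices (λ y → ∑-mono vertices (expand y)) ⟩
    ∑ vertices (λ y → ∑ vertices (λ x → 𝟙 (adj y x) * 𝟙 (adj y z) + 𝟙 (adj y x) * 𝟙 (adj x z)))
      ≡⟨ trans (∑-cong vertices (λ y → ∑-+ vertices _ _)) (∑-+ vertices _ _) ⟩
    ∑ vertices (λ y → ∑ vertices (λ x → 𝟙 (adj y x) * 𝟙 (adj y z))) +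
    ∑ vertices (λ y → ∑ vertices (λ x → 𝟙 (adj y x) * 𝟙 (adj x z)))
      ≡⟨ cong (λ s → ∑ vertices (λ y → ∑ vertices (λ x → 𝟙 (adj y x) * 𝟙 (adj y z))) + s)
           (∑-swap vertices vertices (λ y x → 𝟙 (adj y x) * 𝟙 (adj x z))) ⟩
    ∑ vertices (λ y → ∑ vertices (λ x → 𝟙 (adj y x) * 𝟙 (adj y z))) +
    ∑ vertices (λ x → ∑ vertices (λ y → 𝟙 (adj y x) * 𝟙 (adj x z)))
      -- After the swap the end adjacent to `z` is the outer variable in both sums; `flip adj`
      -- accounts for the reversed arc in the second.
      ≤⟨ +-mono-≤ (paths adj ∑-adj) (paths (flip adj) ∑-adj′) ⟩
    Δ * Δ + Δ * Δ
      ≡⟨ cong (λ s → Δ * Δ + s) (sym (+-identityʳ (Δ * Δ))) ⟩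
    2 * (Δ * Δ) ∎
    where
    open ≤-Reasoning
    expand : ∀ y x → 𝟙 (scope (y , x) z) ≤ 𝟙 (adj y x) * 𝟙 (adj y z) + 𝟙 (adj y x) * 𝟙 (adj x z)
    expand y x = ≤-trans (≤-reflexive (𝟙-∧ (adj y x) (adj y z ∨ adj x z)))
      (≤-trans (*-monoʳ-≤ (𝟙 (adj y x)) (𝟙-∨ (adj y z) (adj x z)))
               (≤-reflexive (*-distribˡ-+ (𝟙 (adj y x)) (𝟙 (adj y z)) (𝟙 (adj x z)))))
    paths : ∀ a → (∀ u → ∑ vertices (λ v → 𝟙 (a u v)) ≤ Δ) →
            ∑ vertices (λ u → ∑ vertices (λ v → 𝟙 (a u v) * 𝟙 (adj u z))) ≤ Δ * Δ
    paths a a≤Δ = begin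
      ∑ vertices (λ u → ∑ vertices (λ v → 𝟙 (a u v) * 𝟙 (adj u z)))
        ≡⟨ ∑-cong vertices (λ u → ∑-*ʳ vertices (𝟙 (adj u z)) (λ v → 𝟙 (a u v))) ⟩
      ∑ vertices (λ u → ∑ vertices (λ v → 𝟙 (a u v)) * 𝟙 (adj u z))
        ≤⟨ ∑-mono vertices (λ u → *-monoˡ-≤ (𝟙 (adj u z)) (a≤Δ u)) ⟩
      ∑ vertices (λ u → Δ * 𝟙 (adj u z))
        ≡⟨ ∑-*ˡ vertices Δ (λ u → 𝟙 (adj u z)) ⟩
      Δ * ∑ vertices (λ u → 𝟙 (adj u z))
        ≤⟨ *-monoʳ-≤ Δ (∑-adj′ z) ⟩
      Δ * Δ ∎

  dep : Vertex × Vertex → Vertex × Vertex → Bool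
  dep e f = any (λ z → scope e z ∧ scope f z) vertices

  -- Choose a common vertex among the at most 2Δ in the scope of `e`, then one of the at most 2Δ²
  -- pairs whose scope contains it.
  ∑-dep : ∀ e → ∑ pairs (𝟙 ∘ dep e) ≤ 2 * Δ * (2 * (Δ * Δ))
  ∑-dep e = begin
    ∑ pairs (𝟙 ∘ dep e)
      ≤⟨ ∑-mono pairs (λ f → ≤-trans (∑-any (λ z → scope e z ∧ scope f z) vertices)
           (≤-reflexive (∑-cong vertices (λ z → 𝟙-∧ (scope e z) (scope f z))))) ⟩
    ∑ pairs (λ f → ∑ vertices (λ z → 𝟙 (scope e z) * 𝟙 (scope f z)))
      ≡⟨ ∑-swap pairs vertices (λ f z → 𝟙 (scope e z) * 𝟙 (scope f z)) ⟩
    ∑ vertices (λ z → ∑ pairs (λ f → 𝟙 (scope e z) * 𝟙 (scope f z)))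
      ≡⟨ ∑-cong vertices (λ z → ∑-*ˡ pairs (𝟙 (scope e z)) (λ f → 𝟙 (scope f z))) ⟩
    ∑ vertices (λ z → 𝟙 (scope e z) * ∑ pairs (λ f → 𝟙 (scope f z)))
      ≤⟨ ∑-mono vertices (λ z → *-monoʳ-≤ (𝟙 (scope e z)) (∑-scope⁻¹ z)) ⟩
    ∑ vertices (λ z → 𝟙 (scope e z) * (2 * (Δ * Δ)))
      ≡⟨ ∑-*ʳ vertices (2 * (Δ * Δ)) (𝟙 ∘ scope e) ⟩
    ∑ vertices (𝟙 ∘ scope e) * (2 * (Δ * Δ))
      ≤⟨ *-monoˡ-≤ (2 * (Δ * Δ)) (∑-scope e) ⟩
    2 * Δ * (2 * (Δ * Δ)) ∎
    where open ≤-Reasoning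

  b : ℕ
  b = 4 * Δ

  Labelling : Set
  Labelling = Vec (Fin b) order

  labellings : List Labelling
  labellings = words (allFin b) order

  Ωs : List (Vec Labelling t)
  Ωs = words labellings t

  clash : Vertex → Labelling → Vertex → Bool
  clash x w z = not (z ≡ᶠ x) ∧ (lookup w z ≡ᶠ lookup w x)

  collides : Vertex × Vertex → Labelling → Bool
  collides e@(_ , x) w = any (λ z → scope e z ∧ clash x w z) vertices

  bad : Vertex × Vertex → Vec Labelling t → Bool
  bad e@(y , x) ω = adj y x ∧ allᵛ (collides e) ω

  ∑-clash : ∀ x z → b * ∑ labellings (λ w → 𝟙 (clash x w z)) ≤ length labellings
  ∑-clash x z with z Fin.≟ x
  ... | yes _   = ≤-trans (≤-reflexive (trans
    (cong (b *_) (trans (∑-const labellings 0) (*-zeroʳ (length labellings)))) (*-zeroʳ b))) z≤n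
  ... | no  z≢x = ∑-coincide b order z x z≢x

  collides-half : ∀ e → 2 * ∑ labellings (𝟙 ∘ collides e) ≤ length labellings
  collides-half e@(y , x) = *-cancelˡ-≤ (2 * Δ) {{>-nonZero (*-mono-≤ {1} {2} (s≤s z≤n) 0<Δ)}} (begin
    2 * Δ * (2 * ∑ labellings (𝟙 ∘ collides e))
      ≡⟨ regroup Δ (∑ labellings (𝟙 ∘ collides e)) ⟩
    b * ∑ labellings (𝟙 ∘ collides e)
      ≤⟨ *-monoʳ-≤ b (∑-mono labellings (λ w → ≤-trans (∑-any (λ z → scope e z ∧ clash x w z) vertices)
           (≤-reflexive (∑-cong vertices (λ z → 𝟙-∧ (scope e z) (clash x w z)))))) ⟩
    b * ∑ labellings (λ w → ∑ vertices (λ z → 𝟙 (scope e z) * 𝟙 (clash x w z)))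
      ≡⟨ cong (b *_) (∑-swap labellings vertices (λ w z → 𝟙 (scope e z) * 𝟙 (clash x w z))) ⟩
    b * ∑ vertices (λ z → ∑ labellings (λ w → 𝟙 (scope e z) * 𝟙 (clash x w z)))
      ≡⟨ sym (∑-*ˡ vertices b _) ⟩
    ∑ vertices (λ z → b * ∑ labellings (λ w → 𝟙 (scope e z) * 𝟙 (clash x w z)))
      ≡⟨ ∑-cong vertices (λ z → trans (cong (b *_) (∑-*ˡ labellings (𝟙 (scope e z)) (λ w → 𝟙 (clash x w z))))
           (exchange b (𝟙 (scope e z)) (∑ labellings (λ w → 𝟙 (clash x w z))))) ⟩
    ∑ vertices (λ z → 𝟙 (scope e z) * (b * ∑ labellings (λ w → 𝟙 (clash x w z))))
      ≤⟨ ∑-mono vertices (λ z → *-monoʳ-≤ (𝟙 (scope e z)) (∑-clash x z)) ⟩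
    ∑ vertices (λ z → 𝟙 (scope e z) * length labellings)
      ≡⟨ ∑-*ʳ vertices (length labellings) (𝟙 ∘ scope e) ⟩
    ∑ vertices (𝟙 ∘ scope e) * length labellings
      ≤⟨ *-monoˡ-≤ (length labellings) (∑-scope e) ⟩
    2 * Δ * length labellings ∎)
    where
    open ≤-Reasoning
    regroup : ∀ m c → 2 * m * (2 * c) ≡ 4 * m * c
    regroup = solve-∀
    exchange : ∀ l m n → l * (m * n) ≡ m * (l * n)
    exchange = solve-∀

  -- Rounds are the letters of a word over `labellings`, so the words that fail in every round
  -- number the t-th power of the failing labellings.
  bad-rare : ∀ e → 2 ^ t * ∑ Ωs (𝟙 ∘ bad e) ≤ length Ωs
  bad-rare e@(y , x) = begin
    2 ^ t * ∑ Ωs (𝟙 ∘ bad e)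
      ≤⟨ *-monoʳ-≤ (2 ^ t) (∑-mono Ωs (λ ω → 𝟙-∧-≤ʳ (adj y x) (allᵛ (collides e) ω))) ⟩
    2 ^ t * ∑ Ωs (𝟙 ∘ allᵛ (collides e))
      ≡⟨ cong (2 ^ t *_) (∑-allᵛ labellings t (collides e)) ⟩
    2 ^ t * ∑ labellings (𝟙 ∘ collides e) ^ t
      ≡⟨ sym (^-distribʳ-* 2 (∑ labellings (𝟙 ∘ collides e)) t) ⟩
    (2 * ∑ labellings (𝟙 ∘ collides e)) ^ t
      ≤⟨ ^-monoˡ-≤ t (collides-half e) ⟩
    length labellings ^ t
      ≡⟨ sym (length-words labellings t) ⟩
    length Ωs ∎
    where open ≤-Reasoning

  -- The functions respecting `Agree D true` are those determined by the labels on `D` in all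
  -- rounds; `Agree D false` gives those determined by the labels off `D`.
  Agree : (Vertex → Bool) → Bool → Vec Labelling t → Vec Labelling t → Set
  Agree D c = Pointwise (λ _ → Pointwise (λ v a a′ → D v ≡ c → a ≡ a′))

  -- At a single vertex one of the two relations has an absurd premise and is therefore total; the
  -- rest is the product over vertices and then over rounds.
  agree-uncorrelated : ∀ D → Uncorrelated Ωs (Agree D true) (Agree D false)
  agree-uncorrelated D = uncorrelated-words labellings t (λ _ _ _ _ → refl) (λ _ _ _ _ → refl)
    (λ _ → uncorrelated-words (allFin b) order (λ _ _ _ → refl) (λ _ _ _ → refl) single)
    where
    single : ∀ v → Uncorrelated (allFin b) (λ a a′ → D v ≡ true → a ≡ a′) (λ a a′ → D v ≡ false → a ≡ a′)
    single v with D v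
    ... | true  = uncorrelated-const (allFin b) (λ _ _ ())
    ... | false = uncorrelated-sym {xs = allFin b} (uncorrelated-const (allFin b) (λ _ _ ()))

  bad-respects : ∀ e → Respects (Agree (scope e) true) (bad e)
  bad-respects e@(y , x) ω ω′ agree = ∧-congʳ-if (adj y x) λ y~x →
    allᵛ-cong (collides e) ω ω′ λ j → any-cong vertices λ z → ∧-congʳ-if (scope e z) λ z∈e →
      cong₂ (λ a a′ → not (z ≡ᶠ x) ∧ (a ≡ᶠ a′)) (agree j z z∈e)
        -- The vertex `x` lies in the scope itself, being a neighbour of `y`.
        (agree j x (cong (λ p → p ∧ (p ∨ adj x x)) y~x))

  -- Pairs that are not dependent have disjoint scopes, so each event of `S` is determined by labels
  -- outside the scope of `e`.
  far-respects : ∀ e S → All (λ f → not (dep e f) ≡ true) S →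
                 Respects (Agree (scope e) false) (LocalLemma.avoid Ωs bad dep S)
  far-respects e []      _              ω ω′ agree = refl
  far-respects e (f ∷ S) (e⊥f ∷ e⊥S) ω ω′ agree = cong₂ (λ p m → 𝟙 (not p) * m)
    (bad-respects f ω ω′ (λ j v f∋v → agree j v (outside v f∋v)))
    (far-respects e S e⊥S ω ω′ agree)
    where
    outside : ∀ v → scope f v ≡ true → scope e v ≡ false
    outside v f∋v = trans (sym (∧-identityʳ (scope e v))) (trans (cong (scope e v ∧_) (sym f∋v))
      (any-false (λ z → scope e z ∧ scope f z) (not-injective e⊥f) (∈-allFin v)))

  separated : ∀ {y x} w → y ~ x → collides (y , x) w ≡ false → Separates G (lookup w) y x
  separated {y} {x} w y~x none z near z≢x same = contradiction clashing λ ()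
    where
    near-true : y ~ z ⊎ x ~ z → (adj y z ∨ adj x z) ≡ true
    near-true (inj₁ y~z) = cong (_∨ adj x z) (dec-true (y ~? z) y~z)
    near-true (inj₂ x~z) = trans (cong (adj y z ∨_) (dec-true (x ~? z) x~z)) (∨-zeroʳ (adj y z))
    clashing : true ≡ false
    clashing = trans (sym (cong₂ _∧_
      (cong₂ _∧_ (dec-true (y ~? x) y~x) (near-true near))
      (cong₂ (λ p q → not p ∧ q) (dec-false (z Fin.≟ x) z≢x) (dec-true (lookup w z Fin.≟ lookup w x) same))))
      (any-false (λ z → scope (y , x) z ∧ clash x w z) none (∈-allFin z))

  separation : Σ[ c ∈ (Fin t → Vertex → Fin b) ] (∀ y x → y ~ x → ∃[ j ] Separates G (c j) y x)
  separation with LocalLemma.localLemma Ωs bad dep (2 ^ t) (2 * Δ * (2 * (Δ * Δ)))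
      (λ e S e⊥S → agree-uncorrelated (scope e) (𝟙 ∘ bad e) (LocalLemma.avoid Ωs bad dep S)
        (λ ω ω′ agree → cong 𝟙 (bad-respects e ω ω′ agree)) (far-respects e S e⊥S))
      bad-rare nonempty Δ³≤2^t 2<2^t pairs ∑-dep
    where
    4≤b : 4 ≤ b
    4≤b = *-mono-≤ {4} ≤-refl 0<Δ
    2<2^t : 2 < 2 ^ t
    2<2^t = ≤-trans (*-mono-≤ {3} {4} (n≤1+n 3) (*-mono-≤ {1} {2 * Δ} (*-mono-≤ {1} {2} (n≤1+n 1) 0<Δ)
      (*-mono-≤ {1} {2} (n≤1+n 1) (*-mono-≤ 0<Δ 0<Δ)))) Δ³≤2^t
    power-positive : ∀ {A : Set} (xs : List A) n → 0 < length xs → 0 < length (words xs n)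
    power-positive xs n 0<∣xs∣ = subst (0 <_) (sym (length-words xs n)) (m^n>0 (length xs) {{>-nonZero 0<∣xs∣}} n)
    nonempty : 0 < length Ωs
    nonempty = power-positive labellings t (power-positive (allFin b) order
      (subst (0 <_) (sym (length-tabulate {n = b} (λ i → i))) (≤-trans (s≤s z≤n) 4≤b)))
  ... | ω , good = (λ j → lookup (lookup ω j)) , λ y x y~x → separate y x y~x
    where
    separate : ∀ y x → y ~ x → ∃[ j ] Separates G (lookup (lookup ω j)) y x
    separate y x y~x with allᵛ-false (collides (y , x)) ω
      (trans (cong (_∧ allᵛ (collides (y , x)) ω) (sym (dec-true (y ~? x) y~x)))
             (good (∈-cartesianProduct⁺ (∈-allFin y) (∈-allFin x))))
    ... | j , none = j , separated (lookup ω j) y~x none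

-- Colouring the boundary of an independent set

module ArcColouring (G : Graph) (Y : Subset (Graph.order G)) (indep : Graph.Independent G Y) where

  open Graph G

  -- Edges outside the boundary are oriented too, which makes the colouring total; only for boundary
  -- edges is `inner` required to lie in `Y`.
  record Orientation (e : Edge) : Set where
    field
      inner outer : Vertex
      arc         : inner ~ outer
      ends        : (inner ≡ Edge.end₁ e × outer ≡ Edge.end₂ e) ⊎ (inner ≡ Edge.end₂ e × outer ≡ Edge.end₁ e)
      inner∈Y     : EdgeBoundary Y e → inner ∈ˢ Y

  open Orientation

  orient : ∀ e → Orientation e
  orient e@record { end₁ = a ; end₂ = b ; adjacent = a~b } with a ∈? Y
  ... | yes a∈Y = record
    { arc = recompute (a ~? b) a~b ; ends = inj₁ (refl , refl) ; inner∈Y = λ _ → a∈Y }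
  ... | no a∉Y = record
    { arc = ~-sym (recompute (a ~? b) a~b) ; ends = inj₂ (refl , refl) ; inner∈Y = b∈Y }
    where
    b∈Y : EdgeBoundary Y e → b ∈ˢ Y
    b∈Y (_ , _ , inj₁ refl , _ , a∈Y , _) = contradiction a∈Y a∉Y
    b∈Y (_ , _ , inj₂ refl , _ , b∈Y , _) = b∈Y

  ends-only : ∀ {e v} (o : Orientation e) → v ∈ₑ e → v ≡ inner o ⊎ v ≡ outer o
  ends-only o v∈e with ends o | v∈e
  ... | inj₁ (refl , refl) | inj₁ refl = inj₁ refl
  ... | inj₁ (refl , refl) | inj₂ refl = inj₂ refl
  ... | inj₂ (refl , refl) | inj₁ refl = inj₂ refl
  ... | inj₂ (refl , refl) | inj₂ refl = inj₁ refl

  inner∈ₑ : ∀ {e} (o : Orientation e) → inner o ∈ₑ e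
  inner∈ₑ o with ends o
  ... | inj₁ (eq , _) = inj₁ eq
  ... | inj₂ (eq , _) = inj₂ eq

  outer∈ₑ : ∀ {e} (o : Orientation e) → outer o ∈ₑ e
  outer∈ₑ o with ends o
  ... | inj₁ (_ , eq) = inj₂ eq
  ... | inj₂ (_ , eq) = inj₁ eq

  end₁<end₂ : ∀ e → Edge.end₁ e Fin.< Edge.end₂ e
  end₁<end₂ record { end₁ = a ; end₂ = b ; ordered = a<b } = recompute (a Fin.<? b) a<b

  edge-≡ : ∀ {e f} → Edge.end₁ e ≡ Edge.end₁ f → Edge.end₂ e ≡ Edge.end₂ f → e ≡ f
  edge-≡ refl refl = refl

  -- If the ends were matched crosswise, `e` and `f` would list the same two vertices in opposite
  -- orders, although both list them increasingly.
  orientation-injective : ∀ {e f} (o : Orientation e) (p : Orientation f) →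
                          inner o ≡ inner p → outer o ≡ outer p → e ≡ f
  orientation-injective {e} {f} o p i≡ o≡ with ends o | ends p
  ... | inj₁ (a , b) | inj₁ (c , d) = edge-≡ (trans (sym a) (trans i≡ c)) (trans (sym b) (trans o≡ d))
  ... | inj₂ (a , b) | inj₂ (c , d) = edge-≡ (trans (sym b) (trans o≡ d)) (trans (sym a) (trans i≡ c))
  ... | inj₁ (a , b) | inj₂ (c , d) = contradiction (end₁<end₂ e) (Fin.<-asym
          (subst₂ Fin._<_ (trans (sym d) (trans (sym o≡) b)) (trans (sym c) (trans (sym i≡) a)) (end₁<end₂ f)))
  ... | inj₂ (a , b) | inj₁ (c , d) = contradiction (end₁<end₂ e) (Fin.<-asym
          (subst₂ Fin._<_ (trans (sym c) (trans (sym i≡) a)) (trans (sym d) (trans (sym o≡) b)) (end₁<end₂ f)))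

  triangle-adjacent : ∀ {a b c u v} → a ~ b → b ~ c → a ~ c →
    u ≡ a ⊎ u ≡ b ⊎ u ≡ c → v ≡ a ⊎ v ≡ b ⊎ v ≡ c → u ≢ v → u ~ v
  triangle-adjacent ab bc ac (inj₁ refl)        (inj₁ refl)        u≢v = contradiction refl u≢v
  triangle-adjacent ab bc ac (inj₁ refl)        (inj₂ (inj₁ refl)) _   = ab
  triangle-adjacent ab bc ac (inj₁ refl)        (inj₂ (inj₂ refl)) _   = ac
  triangle-adjacent ab bc ac (inj₂ (inj₁ refl)) (inj₁ refl)        _   = ~-sym ab
  triangle-adjacent ab bc ac (inj₂ (inj₁ refl)) (inj₂ (inj₁ refl)) u≢v = contradiction refl u≢v
  triangle-adjacent ab bc ac (inj₂ (inj₁ refl)) (inj₂ (inj₂ refl)) _   = bc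
  triangle-adjacent ab bc ac (inj₂ (inj₂ refl)) (inj₁ refl)        _   = ~-sym ac
  triangle-adjacent ab bc ac (inj₂ (inj₂ refl)) (inj₂ (inj₁ refl)) _   = ~-sym bc
  triangle-adjacent ab bc ac (inj₂ (inj₂ refl)) (inj₂ (inj₂ refl)) u≢v = contradiction refl u≢v

  module _ {t b k : ℕ} (c : Fin t → Vertex → Fin b)
    (separating : ∀ y x → y ~ x → ∃[ j ] Separates G (c j) y x) (tb≤k : t * b ≤ k) where

    block : Edge → Fin t
    block e = proj₁ (separating (inner (orient e)) (outer (orient e)) (arc (orient e)))

    label : Edge → Fin b
    label e = c (block e) (outer (orient e))

    colour : Edge → Fin k
    colour e = inject≤ (combine (block e) (label e)) tb≤k

    Class : Fin k → EdgeSet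
    Class i e = EdgeBoundary Y e × colour e ≡ i

    class-partition : IsPartition (EdgeBoundary Y) Class
    class-partition = ((λ {e} e∈ → colour e , e∈ , refl) , λ (_ , e∈ , _) → e∈) ,
      λ i j i≢j ((_ , ≡i) , (_ , ≡j)) → i≢j (trans (sym ≡i) ≡j)

    -- Equal colours mean a common round and equal labels in it. That round succeeds for `e`, so no
    -- vertex near `e` other than its outer end can carry this label.
    outer-unique : ∀ {e f} → colour e ≡ colour f → outer (orient e) ≢ outer (orient f) →
      ¬ (inner (orient e) ~ outer (orient f) ⊎ outer (orient e) ~ outer (orient f))
    outer-unique {e} {f} same x≢x′ near
      with Fin.combine-injective (block e) (label e) (block f) (label f) (Fin.inject≤-injective tb≤k tb≤k _ _ same)
    ... | j≡ , l≡ = proj₂ (separating (inner (orient e)) (outer (orient e)) (arc (orient e)))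
      (outer (orient f)) near (x≢x′ ∘ sym) (trans (cong (λ j → c j (outer (orient f))) j≡) (sym l≡))

    class-good : ∀ i → Good (Class i)
    class-good i e f (e∈ , e↦i) (f∈ , f↦i) e≢f = λ
      { (inj₁ (apart , u , v , u∈e , v∈f , u~v)) →
          joined (λ x≡x′ → apart (x′ , subst (_∈ₑ e) x≡x′ (outer∈ₑ o) , outer∈ₑ p))
                 (ends-only o u∈e) (ends-only p v∈f) u~v
      ; (inj₂ (_ , _ , _ , ab , bc , ac , e⊆ , f⊆)) →
          triangle (triangle-adjacent ab bc ac (e⊆ y (inner∈ₑ o)) (f⊆ y′ (inner∈ₑ p)))
                   (triangle-adjacent ab bc ac (e⊆ x (outer∈ₑ o)) (f⊆ x′ (outer∈ₑ p))) }
      where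
      o = orient e
      p = orient f
      y = inner o
      x = outer o
      y′ = inner p
      x′ = outer p
      same : colour e ≡ colour f
      same = trans e↦i (sym f↦i)
      y≁y′ : ¬ (y ~ y′)
      y≁y′ = indep y y′ (inner∈Y o e∈) (inner∈Y p f∈)
      joined : ∀ {u v} → x ≢ x′ → u ≡ y ⊎ u ≡ x → v ≡ y′ ⊎ v ≡ x′ → ¬ (u ~ v)
      joined x≢x′ (inj₁ refl) (inj₁ refl) u~v = y≁y′ u~v
      joined x≢x′ (inj₁ refl) (inj₂ refl) u~v = outer-unique {e} {f} same x≢x′ (inj₁ u~v)
      -- The edge from `x` to `y′` is seen from `f`, whose round and label are the same.
      joined x≢x′ (inj₂ refl) (inj₁ refl) u~v = outer-unique {f} {e} (sym same) (x≢x′ ∘ sym) (inj₁ (~-sym u~v))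
      joined x≢x′ (inj₂ refl) (inj₂ refl) u~v = outer-unique {e} {f} same x≢x′ (inj₂ u~v)
      -- Distinct vertices of a triangle are adjacent, so `x` and `x′` must coincide by the
      -- colouring and `y` and `y′` by independence, which makes the edges equal.
      triangle : (y ≢ y′ → y ~ y′) → (x ≢ x′ → x ~ x′) → ⊥
      triangle yy xx with x Fin.≟ x′ | y Fin.≟ y′
      ... | no x≢x′  | _        = outer-unique {e} {f} same x≢x′ (inj₂ (xx x≢x′))
      ... | yes _    | no y≢y′  = y≁y′ (yy y≢y′)
      ... | yes x≡x′ | yes y≡y′ = e≢f (orientation-injective o p y≡y′ x≡x′)

-- Assembling the bounds

degree≤maxDegree : ∀ G v → Graph.degree G v ≤ Graph.maxDegree G
degree≤maxDegree G v = All.lookup (xs≤max 0 (map degree (allFin order))) (∈-map⁺ degree (∈-allFin v))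
  where open Graph G

-- The left side is 16Δ³, and Δ ≤ 2^(l+1) bounds it by 2^(4 + 3(l+1)); this is where t = 3l + 7
-- comes from.
cube-bound : ∀ Δ l → Δ < 2 ^ suc l → 4 * (2 * Δ * (2 * (Δ * Δ))) ≤ 2 ^ (7 + l * 3)
cube-bound Δ l Δ<2^l+1 = begin
  4 * (2 * Δ * (2 * (Δ * Δ)))   ≤⟨ *-monoʳ-≤ 4 (*-mono-≤ (*-monoʳ-≤ 2 Δ≤) (*-monoʳ-≤ 2 (*-mono-≤ Δ≤ Δ≤))) ⟩
  4 * (2 * (2 * q) * (2 * (2 * q * (2 * q))))  ≡⟨ expand q ⟩
  128 * (q * (q * (q * 1)))     ≡⟨ cong (128 *_) (^-*-assoc 2 l 3) ⟩
  2 ^ 7 * 2 ^ (l * 3)           ≡⟨ sym (^-distribˡ-+-* 2 7 (l * 3)) ⟩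
  2 ^ (7 + l * 3)               ∎
  where
  open ≤-Reasoning
  q = 2 ^ l
  Δ≤ : Δ ≤ 2 * q
  Δ≤ = <⇒≤ Δ<2^l+1
  expand : ∀ q → 4 * (2 * (2 * q) * (2 * (2 * q * (2 * q)))) ≡ 128 * (q * (q * (q * 1)))
  expand = solve-∀

boundary-partition : ∀ (G : Graph) Δ l k → let open Graph G in
  (∀ v → degree v ≤ Δ) → 0 < Δ → Δ < 2 ^ suc l → (7 + l * 3) * (4 * Δ) ≤ k →
  ∀ Y → Independent Y →
  Σ[ P ∈ (Fin k → EdgeSet) ] (IsPartition (EdgeBoundary Y) P × (∀ i → Good (P i)))
boundary-partition G Δ l k degree≤Δ 0<Δ Δ<2^l+1 tb≤k Y indep =
  let c , separating = Separation.separation G Δ (7 + l * 3) degree≤Δ 0<Δ (cube-bound Δ l Δ<2^l+1)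
  in Class c separating tb≤k , class-partition c separating tb≤k , class-good c separating tb≤k
  where open ArcColouring G Y indep

theorem3p2 : ∀ (Δ k : ℕ) → 41 ≤ Δ → IsCeiling ((27 * Δ) · ln Δ) (+ k) →
    ∀ (G : Graph) → let open Graph G in
    maxDegree ≡ Δ → (Y : Subset order) → Independent Y →
    Σ[ P ∈ (Fin k → EdgeSet) ] (IsPartition (EdgeBoundary Y) P × (∀ i → Good (P i)))
theorem3p2 Δ k 41≤Δ (27ΔlnΔ≤k , _) G maxDegree≡Δ Y indep =
  let 0<Δ = ≤-trans (s≤s z≤n) 41≤Δ
      l , 2^l≤Δ , Δ<2^l+1 = log₂-bracket Δ 0<Δ
      a≤27lnΔ = lnSum-lower Δ l 41≤Δ 2^l≤Δ Δ<2^l+1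
      -- The colours number tb = (3l + 7) · 4Δ = Δ(28 + 12l); the denominator 27 of the logarithmic
      -- bound cancels against the factor 27Δ.
      tb≤k = ≤-trans (≤-reflexive (regroup Δ l)) (ln-ceiling-lower Δ k (28 + l * 12) a≤27lnΔ 27ΔlnΔ≤k)
  in boundary-partition G Δ l k (λ v → ≤-trans (degree≤maxDegree G v) (≤-reflexive maxDegree≡Δ))
       0<Δ Δ<2^l+1 tb≤k Y indep
  where
  regroup : ∀ Δ l → (7 + l * 3) * (4 * Δ) ≡ Δ * (28 + l * 12)
  regroup = solve-∀
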